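{- Let $\ell>2$ be prime and let $\mathbf{F}=(F_1,F_2)$ be a $2$-dimensional symmetric formal group law over $\mathbb{Z}_\ell$ of height $4$ whose exponent $r$ equals $2$. Let $V$ be the $\mathbb{F}_\ell$-vector space of $\ell$-torsion points of $\mathbf{F}(\overline{\mathfrak{m}})$ and $\alpha=1/(\ell^2-1)$. Then for every non-zero $(x_0,y_0)\in V$ we have $\min\{v(x_0),v(y_0)\}=\alpha$.
   Context: $v$ is the valuation on $\overline{\mathbb{Q}}_\ell$ with $v(\ell)=1$, $\overline{\mathfrak{m}}=\{x:v(x)>0\}$, and $\mathbf{F}(\overline{\mathfrak{m}})$ is $\overline{\mathfrak{m}}\times\overline{\mathfrak{m}}$ with the group law $(\mathbf{x},\mathbf{y})\mapsto(F_1(\mathbf{x},\mathbf{y}),F_2(\mathbf{x},\mathbf{y}))$. The formal group law is symmetric if $F_2(X_2,X_1,Y_2,Y_1)=F_1(X_1,X_2,Y_1,Y_2)$. The multiplication-by-$\ell$ series $[\ell]=([\ell]_1,[\ell]_2)$ is defined by $[1](\mathbf{Z})=\mathbf{Z}$, $[m+1](\mathbf{Z})=\mathbf{F}(\mathbf{Z},[m](\mathbf{Z}))$. The height of $\mathbf{F}$ is the height of its reduction $\overline{\mathbf{F}}$ mod $\ell$: $\ell^h=\dim_{\mathbb{F}_\ell}\mathbb{F}_\ell[[Z_1,Z_2]]/\langle\overline{[\ell]}_1,\overline{[\ell]}_2\rangle$. The exponent $r$ of $\mathbf{F}$ is the largest integer $r$ such that both reduced series $\overline{[\ell]}_1,\overline{[\ell]}_2$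 lie in $\mathbb{F}_\ell[[Z_1^{\ell^r},Z_2^{\ell^r}]]$ (equivalently, $\ell^r$ is the smallest exponent to which some variable occurs in a non-zero monomial of some $\overline{[\ell]}_i$). -}

module Defs where

open import Algebra.Apartness.Bundles using (HeytingField; HeytingCommutativeRing)
open import Algebra.Bundles using (CommutativeRing; RawSemiring; Semiring)
open import Algebra.Morphism.Structures using (module RingMorphisms)
open import Algebra.Structures using (IsCommutativeRing)
import Algebra.Definitions.RawSemiring as RawSemiringDefinitions
open import Data.Bool.Base using (if_then_else_)
open import Data.Fin.Base using (Fin; toℕ; _↑ˡ_; _↑ʳ_)
open import Data.Fin.Patterns using (0F; 1F; 2F; 3F)
open import Data.Integer.Base as ℤ using (ℤ; +_)
import Data.Integer.Divisibility.Signed as ℤ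
import Data.Integer.Properties as ℤ
import Data.Integer.Tactic.RingSolver as ℤSolver
open import Data.Nat.Base as ℕ using (ℕ; zero; suc)
import Data.Nat.Divisibility as ℕ
import Data.Nat.Properties as ℕ
open import Data.Product.Base using (∃; ∃-syntax; _×_; _,_)
open import Data.Rational.Base as ℚ using (ℚ; 0ℚ; 1ℚ)
open import Data.Vec.Base using (Vec; []; _∷_; lookup; replicate; zipWith; _[_]≔_)
import Data.Vec.Base as Vec
open import Data.Vec.Functional using (Vector; _++_)
open import Data.Vec.Properties using (≡-dec)
open import Data.Vec.Relation.Unary.All using (All)
open import Function.Bundles using (_⇔_)
open import Level using (Level; 0ℓ; _⊔_) renaming (suc to lsuc)
open import Relation.Binary.Construct.Add.Supremum.NonStrict ℚ._≤_ using (_≤⁺_)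
open import Relation.Binary.Construct.Add.Supremum.Strict ℚ._<_ using (_<⁺_)
open import Relation.Binary.PropositionalEquality.Core
  using (_≡_; refl; sym; subst)
open import Relation.Nullary.Construct.Add.Supremum using (_⁺; ⊤⁺; [_])
open import Relation.Nullary.Decidable.Core using (does)
open import Relation.Nullary.Negation.Core using (¬_)

private
  variable
    c ℓ₁ ℓ₂ : Level
    n m k d : ℕ

infix 4 _≈_[mod_]

record _≈_[mod_] (x y : ℤ) (m : ℕ) : Set where
  constructor mod
  field difference : + m ℤ.∣ x ℤ.- y

open _≈_[mod_] public

module _ {m : ℕ} where

  ≡⇒≈mod : ∀ {x y} → x ≡ y → x ≈ y [mod m ]
  ≡⇒≈mod {x} refl = mod (ℤ.divides (+ 0) (ℤ.i≡j⇒i-j≡0 (refl {x = x})))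

  ≈mod-sym : ∀ {x y} → x ≈ y [mod m ] → y ≈ x [mod m ]
  ≈mod-sym {x} {y} (mod p) = mod (subst (+ m ℤ.∣_) (eq x y) (ℤ.∣m⇒∣-m p))
    where
    eq : ∀ x y → ℤ.- (x ℤ.- y) ≡ y ℤ.- x
    eq = ℤSolver.solve-∀

  ≈mod-trans : ∀ {x y z} → x ≈ y [mod m ] → y ≈ z [mod m ] → x ≈ z [mod m ]
  ≈mod-trans {x} {y} {z} (mod p) (mod q) =
    mod (subst (+ m ℤ.∣_) (eq x y z) (ℤ.∣m∣n⇒∣m+n p q))
    where
    eq : ∀ x y z → (x ℤ.- y) ℤ.+ (y ℤ.- z) ≡ x ℤ.- z
    eq = ℤSolver.solve-∀

  +-congmod : ∀ {x y u w} → x ≈ y [mod m ] → u ≈ w [mod m ] →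
              x ℤ.+ u ≈ y ℤ.+ w [mod m ]
  +-congmod {x} {y} {u} {w} (mod p) (mod q) =
    mod (subst (+ m ℤ.∣_) (eq x y u w) (ℤ.∣m∣n⇒∣m+n p q))
    where
    eq : ∀ x y u w → (x ℤ.- y) ℤ.+ (u ℤ.- w) ≡ (x ℤ.+ u) ℤ.- (y ℤ.+ w)
    eq = ℤSolver.solve-∀

  *-congmod : ∀ {x y u w} → x ≈ y [mod m ] → u ≈ w [mod m ] →
              x ℤ.* u ≈ y ℤ.* w [mod m ]
  *-congmod {x} {y} {u} {w} (mod p) (mod q) =
    mod (subst (+ m ℤ.∣_) (eq x y u w)
      (ℤ.∣m∣n⇒∣m+n (ℤ.∣n⇒∣m*n x q) (ℤ.∣m⇒∣m*n w p)))
    where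
    eq : ∀ x y u w → x ℤ.* (u ℤ.- w) ℤ.+ (x ℤ.- y) ℤ.* w ≡ x ℤ.* u ℤ.- y ℤ.* w
    eq = ℤSolver.solve-∀

  -‿congmod : ∀ {x y} → x ≈ y [mod m ] → ℤ.- x ≈ ℤ.- y [mod m ]
  -‿congmod {x} {y} (mod p) = mod (subst (+ m ℤ.∣_) (eq x y) (ℤ.∣m⇒∣-m p))
    where
    eq : ∀ x y → ℤ.- (x ℤ.- y) ≡ ℤ.- x ℤ.- ℤ.- y
    eq = ℤSolver.solve-∀

ℤ/_ : ℕ → CommutativeRing 0ℓ 0ℓ
ℤ/ m = record
  { Carrier = ℤ
  ; _≈_ = _≈_[mod m ]
  ; _+_ = ℤ._+_ ; _*_ = ℤ._*_ ; -_ = ℤ.-_ ; 0# = + 0 ; 1# = + 1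
  ; isCommutativeRing = record
    { isRing = record
      { +-isAbelianGroup = record
        { isGroup = record
          { isMonoid = record
            { isSemigroup = record
              { isMagma = record
                { isEquivalence = record
                  { refl = ≡⇒≈mod refl ; sym = ≈mod-sym ; trans = ≈mod-trans }
                ; ∙-cong = +-congmod }
              ; assoc = λ x y z → ≡⇒≈mod (ℤ.+-assoc x y z) }
            ; identity = (λ x → ≡⇒≈mod (ℤ.+-identityˡ x))
                       , (λ x → ≡⇒≈mod (ℤ.+-identityʳ x)) }
          ; inverse = (λ x → ≡⇒≈mod (ℤ.+-inverseˡ x))
                    , (λ x → ≡⇒≈mod (ℤ.+-inverseʳ x))
          ; ⁻¹-cong = -‿congmod }
        ; comm = λ x y → ≡⇒≈mod (ℤ.+-comm x y) }
      ; *-cong = *-congmod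
      ; *-assoc = λ x y z → ≡⇒≈mod (ℤ.*-assoc x y z)
      ; *-identity = (λ x → ≡⇒≈mod (ℤ.*-identityˡ x))
                   , (λ x → ≡⇒≈mod (ℤ.*-identityʳ x))
      ; distrib = (λ x y z → ≡⇒≈mod (ℤ.*-distribˡ-+ x y z))
                , (λ x y z → ≡⇒≈mod (ℤ.*-distribʳ-+ x y z)) }
    ; *-comm = λ x y → ≡⇒≈mod (ℤ.*-comm x y) } }

-- ℤ_p is the inverse limit of the rings ℤ/pⁿ.

module _ (p : ℕ) where

  record PAdic : Set where
    constructor padic
    field
      approx   : ℕ → ℤ
      coherent : ∀ n → approx (suc n) ≈ approx n [mod p ℕ.^ n ]

open PAdic public

record _≈ₚ_ {p : ℕ} (a b : PAdic p) : Set where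
  constructor levelwise
  field at : ∀ n → approx a n ≈ approx b n [mod p ℕ.^ n ]

open _≈ₚ_ public

module _ {p : ℕ} where

  constₚ : ℤ → PAdic p
  constₚ x = padic (λ _ → x) (λ _ → ≡⇒≈mod refl)

  infixl 6 _+ₚ_
  infixl 7 _*ₚ_
  infix  8 -ₚ_

  _+ₚ_ _*ₚ_ : PAdic p → PAdic p → PAdic p
  padic a α +ₚ padic b β =
    padic (λ n → a n ℤ.+ b n) (λ n → +-congmod (α n) (β n))
  padic a α *ₚ padic b β =
    padic (λ n → a n ℤ.* b n) (λ n → *-congmod (α n) (β n))

  -ₚ_ : PAdic p → PAdic p
  -ₚ padic a α = padic (λ n → ℤ.- a n) (λ n → -‿congmod (α n))

ℤₚ : ℕ → CommutativeRing 0ℓ 0ℓ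
ℤₚ p = record
  { Carrier = PAdic p
  ; _≈_ = _≈ₚ_
  ; _+_ = _+ₚ_ ; _*_ = _*ₚ_ ; -_ = -ₚ_ ; 0# = constₚ (+ 0) ; 1# = constₚ (+ 1)
  ; isCommutativeRing = record
    { isRing = record
      { +-isAbelianGroup = record
        { isGroup = record
          { isMonoid = record
            { isSemigroup = record
              { isMagma = record
                { isEquivalence = record
                  { refl = levelwise λ n → R.refl n
                  ; sym = λ e → levelwise λ n → R.sym n (at e n)
                  ; trans = λ e f → levelwise λ n → R.trans n (at e n) (at f n) }
                ; ∙-cong = λ e f → levelwise λ n → R.+-cong n (at e n) (at f n) }
              ; assoc = λ x y z → levelwise λ n → R.+-assoc n (approx x n) (approx y n) (approx z n) }
            ; identity = (λ x → levelwise λ n → R.+-identityˡ n (approx x n))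
                       , (λ x → levelwise λ n → R.+-identityʳ n (approx x n)) }
          ; inverse = (λ x → levelwise λ n → R.-‿inverseˡ n (approx x n))
                    , (λ x → levelwise λ n → R.-‿inverseʳ n (approx x n))
          ; ⁻¹-cong = λ e → levelwise λ n → R.-‿cong n (at e n) }
        ; comm = λ x y → levelwise λ n → R.+-comm n (approx x n) (approx y n) }
      ; *-cong = λ e f → levelwise λ n → R.*-cong n (at e n) (at f n)
      ; *-assoc = λ x y z → levelwise λ n → R.*-assoc n (approx x n) (approx y n) (approx z n)
      ; *-identity = (λ x → levelwise λ n → R.*-identityˡ n (approx x n))
                   , (λ x → levelwise λ n → R.*-identityʳ n (approx x n))
      ; distrib = (λ x y z → levelwise λ n → R.distribˡ n (approx x n) (approx y n) (approx z n))
                , (λ x y z → levelwise λ n → R.distribʳ n (approx x n) (approx y n) (approx z n)) }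
    ; *-comm = λ x y → levelwise λ n → R.*-comm n (approx x n) (approx y n) } }
  where module R n = CommutativeRing (ℤ/ (p ℕ.^ n))

reduce : ∀ {p} → PAdic p → ℤ
reduce a = approx a 1

-- Monomials in n variables are represented by their exponent vectors.

module Monomials (S : RawSemiring c ℓ₁) where

  open RawSemiring S using (Carrier)
  open RawSemiringDefinitions S public using (sum; product; _^_)

  ∑≤ : Vec ℕ n → (Vec ℕ n → Carrier) → Carrier
  ∑≤ []       f = f []
  ∑≤ (b ∷ bs) f = sum {suc b} (λ i → ∑≤ bs (λ a → f (toℕ i ∷ a)))

  _^^_ : Vector Carrier n → Vec ℕ n → Carrier
  x ^^ a = product (λ i → x i ^ lookup a i)

module PowerSeries (R : RawSemiring c ℓ₁) where

  open RawSemiring R using (Carrier; _≈_; 0#; 1#)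
    renaming (_+_ to _+ᴿ_; _*_ to _*ᴿ_)
  private module ΣR = Monomials R

  Series : ℕ → Set c
  Series n = Vec ℕ n → Carrier

  degree : Vec ℕ n → ℕ
  degree = Vec.sum

  infix  4 _≋_
  infixl 6 _+_
  infixl 7 _*_ _•_

  _≋_ : Series n → Series n → Set ℓ₁
  f ≋ g = ∀ e → f e ≈ g e

  mono : Vec ℕ n → Series n
  mono a e = if does (≡-dec ℕ._≟_ e a) then 1# else 0#

  X : Vector (Series n) n
  X {n} i = mono (replicate n 0 [ i ]≔ 1)

  _+_ _*_ : Series n → Series n → Series n
  (f + g) e = f e +ᴿ g e
  (f * g) e = ΣR.∑≤ e (λ a → f a *ᴿ g (zipWith ℕ._∸_ e a))

  _•_ : Carrier → Series n → Series n
  (r • f) e = r *ᴿ f e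

  rawSemiring : ℕ → RawSemiring c ℓ₁
  rawSemiring n = record
    { Carrier = Series n
    ; _≈_ = _≋_
    ; _+_ = _+_
    ; _*_ = _*_
    ; 0#  = λ _ → 0#
    ; 1#  = mono (replicate n 0)
    }

  module Σ {n : ℕ} = Monomials (rawSemiring n)

  -- Substitution f(g₁,…,gₙ) for series gᵢ without constant term: then only
  -- the gᵃ with |a| ≤ |e| contribute to the coefficient of e, so the box of
  -- side |e| contains every non-zero contribution.

  infix 9 _⟪_⟫

  _⟪_⟫ : Series n → Vector (Series m) n → Series m
  _⟪_⟫ {n = n} f g e =
    ΣR.∑≤ (replicate n (degree e)) (λ a → f a *ᴿ (g Σ.^^ a) e)

  combination : Vector Carrier d → Vector (Series n) d → Series n
  combination r b = Σ.sum (λ j → r j • b j)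

  infix 4 _∈⟨_⟩

  _∈⟨_⟩ : Series n → Vector (Series n) k → Set (c ⊔ ℓ₁)
  _∈⟨_⟩ {n} {k} f g =
    ∃ λ (q : Vector (Series n) k) → f ≋ Σ.sum (λ i → q i * g i)

  -- For R a field: R[[X₁,…,Xₙ]]/⟨g₁,…,gₖ⟩ has an R-basis of d elements, given
  -- by representatives.

  record QuotientHasDimension (g : Vector (Series n) k) (d : ℕ)
         : Set (c ⊔ ℓ₁) where
    field
      basis       : Vector (Series n) d
      spanning    : ∀ (f : Series n) →
                    ∃ λ (r : Vector Carrier d) → ∃ λ (h : Series n) →
                    h ∈⟨ g ⟩ × f ≋ combination r basis + h
      independent : ∀ (r : Vector Carrier d) →
                    combination r basis ∈⟨ g ⟩ → ∀ j → r j ≈ 0#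

  infix 9 _⟪_∥_⟫

  _⟪_∥_⟫ : Vector (Series (n ℕ.+ n)) n →
           (f g : Vector (Series m) n) → Vector (Series m) n
  (F ⟪ f ∥ g ⟫) i = F i ⟪ f ++ g ⟫

  module _ {n : ℕ} where

    X₂ Y₂ : Vector (Series (n ℕ.+ n)) n
    X₂ i = X (i ↑ˡ n)
    Y₂ i = X (n ↑ʳ i)

    X₃ Y₃ Z₃ : Vector (Series (n ℕ.+ (n ℕ.+ n))) n
    X₃ i = X (i ↑ˡ (n ℕ.+ n))
    Y₃ i = X (n ↑ʳ (i ↑ˡ n))
    Z₃ i = X (n ↑ʳ (n ↑ʳ i))

  -- Commutative formal group laws of dimension n; the first n of the n + n
  -- variables of F i are X and the last n are Y.

  record FormalGroupLaw (n : ℕ) : Set (c ⊔ ℓ₁) where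
    field
      F      : Vector (Series (n ℕ.+ n)) n
      linear : ∀ i e → degree e ℕ.≤ 1 → F i e ≈ (X₂ i + Y₂ i) e
      assoc  : ∀ i → (F ⟪ X₃ ∥ F ⟪ Y₃ ∥ Z₃ ⟫ ⟫) i ≋ (F ⟪ F ⟪ X₃ ∥ Y₃ ⟫ ∥ Z₃ ⟫) i
      comm   : ∀ i → (F ⟪ Y₂ ∥ X₂ ⟫) i ≋ F i

    -- The case 0 is a convention; the definition starts at [1](Z) = Z.
    mult : ℕ → Vector (Series n) n
    mult zero          = λ _ _ → 0#
    mult (suc zero)    = X
    mult (suc (suc m)) = F ⟪ X ∥ mult (suc m) ⟫

  Symmetric : FormalGroupLaw 2 → Set ℓ₁
  Symmetric 𝐅 = F 1F ⟪ swapped ⟫ ≋ F 0F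
    where
    open FormalGroupLaw 𝐅
    swapped : Vector (Series 4) 4
    swapped 0F = X 1F
    swapped 1F = X 0F
    swapped 2F = X 3F
    swapped 3F = X 2F

module _ (p : ℕ) where

  rawℤₚ rawℤ/p : RawSemiring 0ℓ 0ℓ
  rawℤₚ  = Semiring.rawSemiring (CommutativeRing.semiring (ℤₚ p))
  rawℤ/p = Semiring.rawSemiring (CommutativeRing.semiring (ℤ/ p))

module _ {p : ℕ} (𝐅 : PowerSeries.FormalGroupLaw (rawℤₚ p) n) where

  open PowerSeries (rawℤ/p p)

  reduced[p] : Vector (Series n) n
  reduced[p] i e = reduce (PowerSeries.FormalGroupLaw.mult 𝐅 p i e)

  HasHeight : ℕ → Set
  HasHeight h = QuotientHasDimension reduced[p] (p ℕ.^ h)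

  InPowers : ℕ → Set
  InPowers r = ∀ i e → ¬ All (p ℕ.^ r ℕ.∣_) e → reduced[p] i e ≈ + 0 [mod p ]

  HasExponent : ℕ → Set
  HasExponent r = InPowers r × (∀ s → InPowers s → s ℕ.≤ r)

infixl 6 _+⁺_
infixl 7 _⊓⁺_

_+⁺_ _⊓⁺_ : ℚ ⁺ → ℚ ⁺ → ℚ ⁺
[ x ] +⁺ [ y ] = [ x ℚ.+ y ]
[ _ ] +⁺ ⊤⁺    = ⊤⁺
⊤⁺    +⁺ _     = ⊤⁺

[ x ] ⊓⁺ [ y ] = [ x ℚ.⊓ y ]
[ x ] ⊓⁺ ⊤⁺    = [ x ]
⊤⁺    ⊓⁺ y     = y

heytingField⇒commutativeRing : HeytingField c ℓ₁ ℓ₂ → CommutativeRing c ℓ₁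
heytingField⇒commutativeRing K = HeytingCommutativeRing.commutativeRing
  (HeytingField.heytingCommutativeRing K)

-- Models of an algebraic closure of ℚ_p together with its valuation; this
-- determines the pair up to isomorphism.

record ValuedAlgebraicClosure (p : ℕ) c ℓ₁ ℓ₂ : Set (lsuc (c ⊔ ℓ₁ ⊔ ℓ₂)) where
  field
    field# : HeytingField c ℓ₁ ℓ₂

  commutativeRing : CommutativeRing c ℓ₁
  commutativeRing = heytingField⇒commutativeRing field#

  open CommutativeRing commutativeRing public
    using (Carrier; _≈_; _+_; _*_; _-_; 0#; 1#; rawRing; semiring)
  open Monomials (Semiring.rawSemiring semiring) public
  open RawSemiringDefinitions (Semiring.rawSemiring semiring) public
    using () renaming (_×_ to _·_)

  private
    module ℤₚ = CommutativeRing (ℤₚ p)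

  field
    ι                 : PAdic p → Carrier
    ι-isHomomorphism  : RingMorphisms.IsRingHomomorphism ℤₚ.rawRing rawRing ι

    algebraicallyClosed : ∀ n (a : Vector Carrier (suc n)) →
      ∃[ x ] sum (λ i → a i * x ^ toℕ i) + x ^ suc n ≈ 0#

    -- Denominators are cleared, so that coefficients may be taken in ℤ_p
    -- instead of its fraction field.
    algebraic : ∀ x → ∃ λ (n : ℕ) → ∃ λ (a : Vector (PAdic p) n) →
      (∃[ j ] ¬ (a j ℤₚ.≈ ℤₚ.0#)) × sum (λ i → ι (a i) * x ^ toℕ i) ≈ 0#

    v      : Carrier → ℚ ⁺
    v-cong : ∀ {x y} → x ≈ y → v x ≡ v y
    v-∞    : ∀ x → v x ≡ ⊤⁺ ⇔ x ≈ 0#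
    v-*    : ∀ x y → v (x * y) ≡ v x +⁺ v y
    v-+    : ∀ x y → v x ⊓⁺ v y ≤⁺ v (x + y)

    -- Together these say that v extends the p-adic valuation.
    v-ℤₚ   : ∀ a → [ 0ℚ ] ≤⁺ v (ι a)
    v-p    : v (p · 1#) ≡ [ 1ℚ ]

  open PowerSeries (rawℤₚ p) using (Series; FormalGroupLaw)

  partialSum : Series n → Vector Carrier n → ℕ → Carrier
  partialSum {n} f x N = ∑≤ (replicate n N) (λ a → ι (f a) * (x ^^ a))

  infix 4 _⟨_⟩⟶_

  _⟨_⟩⟶_ : Series n → Vector Carrier n → Carrier → Set
  f ⟨ x ⟩⟶ z = ∀ M → ∃[ N₀ ] ∀ N → N₀ ℕ.≤ N →
    [ + M ℚ./ 1 ] ≤⁺ v (partialSum f x N - z)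

  In𝔪̄ : Vector Carrier n → Set
  In𝔪̄ x = ∀ i → [ 0ℚ ] <⁺ v (x i)

  IsZero : Vector Carrier n → Set ℓ₁
  IsZero x = ∀ i → x i ≈ 0#

  module _ (𝐅 : FormalGroupLaw n) where

    open FormalGroupLaw 𝐅 using (F)

    _⊕_≐_ : (x y z : Vector Carrier n) → Set
    x ⊕ y ≐ z = ∀ i → F i ⟨ x ++ y ⟩⟶ z i

    -- The group operation is kept as a relation: the existence of its values
    -- rests on completeness of the finite extensions of ℚ_p.

    data Multiple (x : Vector Carrier n) : ℕ → Vector Carrier n → Set c where
      one : Multiple x 1 x
      add : ∀ {m y z} → Multiple x m y → In𝔪̄ z → x ⊕ y ≐ z →
            Multiple x (suc m) z

    record Torsion (m : ℕ) (x : Vector Carrier n) : Set (c ⊔ ℓ₁) where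
      field
        inside : In𝔪̄ x
        kills  : ∃[ z ] Multiple x m z × IsZero z

α : (p : ℕ) → 2 ℕ.< p → ℚ
α p 2<p = (+ 1 ℚ./ (p ℕ.^ 2 ℕ.∸ 1)) {{ℕ.>-nonZero (ℕ.m<n⇒0<n∸m 1<p²)}}
  where
  1<p² : 1 ℕ.< p ℕ.^ 2
  1<p² = ℕ.^-monoˡ-< 2 {1} {p} (ℕ.<-trans (ℕ.s≤s (ℕ.s≤s ℕ.z≤n)) 2<p)

{-# OPTIONS --safe #-}

-- Let q = ℓ². Since the exponent is 2, the reduction of [ℓ] is a series in
-- Z₁^q, Z₂^q; the height being 4, its quotient ring has dimension q², which forces
-- the matrix A of coefficients at Z₁^q, Z₂^q to be invertible modulo ℓ. Hence
--   [ℓ]ᵢ(x) = ℓ xᵢ + Aᵢ₁ x₁^q + Aᵢ₂ x₂^q + terms of larger valuation,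
-- and with μ = min(v x₁, v x₂) the vector ℓ x has minimal valuation 1 + μ while
-- A x^q has minimal valuation qμ. At an ℓ-torsion point they cancel, so 1 + μ = qμ.
--
-- Convergence is avoided by evaluating series in the ring of integers modulo the
-- elements of valuation greater than s, where points of 𝔪̄ are nilpotent.

module Submission where

open import Defs
import Algebra.Definitions.RawMonoid
open import Algebra.Bundles using (CommutativeRing; Semiring)
open import Algebra.Morphism.Structures using (module RingMorphisms; module SemiringMorphisms)
import Algebra.Properties.AbelianGroup as AbelianGroupProperties
import Algebra.Properties.CommutativeMonoid.Sum as CommutativeMonoidSum
import Algebra.Properties.CommutativeSemigroup as CommutativeSemigroupProperties
import Algebra.Properties.Group as GroupProperties
import Algebra.Properties.Monoid.Mult as MonoidMult
import Algebra.Properties.Ring as RingProperties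
import Algebra.Properties.Semiring.Exp as Exp
import Algebra.Properties.Semiring.Sum as SemiringSum
open import Data.Bool.Base using (if_then_else_)
open import Data.Empty using (⊥; ⊥-elim)
open import Data.Fin.Base as Fin
  using (Fin; zero; suc; toℕ; fromℕ<; splitAt; combine; finToFun; funToFin; _↑ˡ_; _↑ʳ_)
open import Data.Fin.Patterns using (0F; 1F)
import Data.Fin.Properties as Fin
open import Data.Integer.Base as ℤ using (ℤ; +_; -[1+_])
open import Data.Integer.DivMod using (_%ℕ_; _/ℕ_; n%ℕd<d; a≡a%ℕn+[a/ℕn]*n)
import Data.Integer.Divisibility.Signed as ℤ
import Data.Integer.Properties as ℤ
import Data.Integer.Tactic.RingSolver as ℤSolver
open import Data.List.Base as List using (List; []; _∷_)
open import Data.List.Membership.Propositional using (_∉_)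
open import Data.List.Relation.Unary.All as ListAll using ([]; _∷_)
open import Data.List.Relation.Unary.AllPairs using ([]; _∷_)
open import Data.List.Relation.Unary.Any using (here; there)
open import Data.List.Relation.Unary.Unique.Propositional using (Unique)
open import Data.Nat.Base as ℕ using (ℕ; zero; suc; _≤_; _<_; z≤n; s≤s)
import Data.Nat.Coprimality as Coprimality
import Data.Nat.Divisibility as ℕ
open import Data.Nat.GCD using (module Bézout)
open import Data.Nat.Primality using (Prime; euclidsLemma; prime⇒nonTrivial; prime⇒nonZero)
import Data.Nat.Properties as ℕ
open import Data.Product.Base using (_×_; _,_; ∃; proj₁; proj₂)
open import Data.Rational.Base as ℚ using (ℚ; mkℚ; 0ℚ; 1ℚ; *<*)
import Data.Rational.Properties as ℚ
import Data.Rational.Unnormalised.Base as ℚᵘ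
import Data.Rational.Unnormalised.Properties as ℚᵘ
open import Data.Sum.Base as Sum using (_⊎_; inj₁; inj₂)
open import Data.Vec.Base using (Vec; []; _∷_; replicate; zipWith; lookup; _[_]≔_)
  renaming (sum to degree)
import Data.Vec.Functional as Vector
open import Data.Vec.Functional using (Vector; _++_)
open import Data.Vec.Functional.Properties using (lookup-++ˡ; lookup-++ʳ)
open import Data.Vec.Properties using (≡-dec; ∷-injectiveˡ; ∷-injectiveʳ)
open import Data.Vec.Relation.Binary.Pointwise.Inductive as Pointwise using (Pointwise; []; _∷_)
open import Data.Vec.Relation.Unary.All as VecAll using (All; []; _∷_)
open import Function.Base using (_∘_)
open import Function.Bundles using (Equivalence)
open import Level using (_⊔_)
open import Relation.Binary.Construct.Add.Supremum.NonStrict ℚ._≤_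
  using (_≤⁺_; _≤⊤⁺; [_]; ≤⁺-trans; ≤⁺-dec)
open import Relation.Binary.Construct.Add.Supremum.Strict ℚ._<_
  using (_<⁺_; [_]; [_]<⊤⁺; <⁺-transˡ)
open import Relation.Binary.Definitions using (Tri; tri<; tri≈; tri>)
open import Relation.Binary.PropositionalEquality as ≡ using (_≡_; _≢_)
open import Relation.Nullary.Construct.Add.Supremum using (⊤⁺; [_]; []-injective)
open import Relation.Nullary.Decidable using (Dec; does; yes; no; dec-true; dec-false; recompute)
open import Relation.Nullary.Negation using (¬_; contradiction)

-- The obstacle is that values of series are given only as limits, and multiples of a point only
-- through the relation `Multiple`, so substituting one series into another would require exchanging
-- limits. Modulo valuation greater than s every limit is attained at a finite stage, and the
-- exchange becomes a rearrangement of finite sums. The bound s is a free parameter. It is set to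
-- the smaller of 1 + μ and qμ: the terms on the other side then vanish, whereas a term of valuation
-- exactly s does not, because the bound is strict. So neither of the two numbers can be the smaller
-- one. The linear part ℓ Z of [ℓ] comes from F = X + Y + terms of degree at least 2, by restricting
-- to points at which all products of coordinates vanish. The dimension of the quotient ring enters
-- through counting: over a finite field, d spanning elements have only ℓ^d combinations up to
-- congruence.

private
  variable
    n m k p : ℕ

-- Sums over boxes of exponents

infix 4 _≤ᵛ_

_≤ᵛ_ : ∀ {n} → Vec ℕ n → Vec ℕ n → Set
_≤ᵛ_ = Pointwise _≤_

infixl 6 _∸ᵛ_

_∸ᵛ_ : ∀ {n} → Vec ℕ n → Vec ℕ n → Vec ℕ n
_∸ᵛ_ = zipWith ℕ._∸_

0≤ᵛ : ∀ {n} (b : Vec ℕ n) → replicate n 0 ≤ᵛ b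
0≤ᵛ []       = []
0≤ᵛ (b ∷ bs) = z≤n ∷ 0≤ᵛ bs

_≟ᵛ_ : ∀ {n} (a b : Vec ℕ n) → Dec (a ≡ b)
_≟ᵛ_ = ≡-dec ℕ._≟_

module BoxSums {c ℓ} (A : CommutativeRing c ℓ) where

  open CommutativeRing A
  open Monomials (Semiring.rawSemiring semiring)
  open CommutativeMonoidSum +-commutativeMonoid
    using (sum-cong-≋; ∑-distrib-+; ∑-comm; sum-remove; sum-replicate-zero)
  open SemiringSum semiring using (*-distribˡ-sum; *-distribʳ-sum)
  open import Relation.Binary.Reasoning.Setoid setoid

  sum-zero : (t : Vector Carrier n) → (∀ i → t i ≈ 0#) → sum t ≈ 0#
  sum-zero {n} t t≈0 = trans (sum-cong-≋ t≈0) (sum-replicate-zero n)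

  sum-single : (t : Vector Carrier n) (i : Fin n) →
               (∀ j → j ≢ i → t j ≈ 0#) → sum t ≈ t i
  sum-single {suc n} t i t≈0 = begin
    sum t                        ≈⟨ sum-remove {i = i} t ⟩
    t i + sum (Vector.removeAt t i)
      ≈⟨ +-congˡ (sum-zero (Vector.removeAt t i) λ j → t≈0 _ (Fin.punchInᵢ≢i i j)) ⟩
    t i + 0#                     ≈⟨ +-identityʳ _ ⟩
    t i                          ∎

  sum-extend : ∀ {m n} (g : ℕ → Carrier) → m ≤ n → (∀ i → m ≤ i → g i ≈ 0#) →
               sum {m} (g ∘ toℕ) ≈ sum {n} (g ∘ toℕ)
  sum-extend {n = n} g z≤n g≈0 = sym (sum-zero {n} _ λ i → g≈0 (toℕ i) z≤n)
  sum-extend g (s≤s m≤n) g≈0 =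
    +-congˡ (sum-extend (g ∘ suc) m≤n λ i m≤i → g≈0 (suc i) (s≤s m≤i))

  -- Both sides run over the pairs (j, k) with j + k ≤ b, once by diagonals and once by rows.
  -- Splitting off the row j = 0 leaves the triangle of size b - 1 for `h ∘ suc`.
  sum-triangle : ∀ b (h : ℕ → ℕ → Carrier) →
    sum {suc b} (λ i → sum {suc (toℕ i)} (λ j → h (toℕ j) (toℕ i ℕ.∸ toℕ j))) ≈
    sum {suc b} (λ j → sum {suc (b ℕ.∸ toℕ j)} (λ k → h (toℕ j) (toℕ k)))
  sum-triangle zero    h = refl
  sum-triangle (suc b) h = begin
    sum {suc (suc b)} (λ i → h 0 (toℕ i) + T i)
      ≈⟨ ∑-distrib-+ {suc (suc b)} (λ i → h 0 (toℕ i)) T ⟩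
    sum {suc (suc b)} (λ k → h 0 (toℕ k)) + (0# + sum (T ∘ suc))
      ≈⟨ +-congˡ (trans (+-identityˡ _) (sum-triangle b (h ∘ suc))) ⟩
    sum {suc (suc b)} (λ j → sum {suc (suc b ℕ.∸ toℕ j)} (λ k → h (toℕ j) (toℕ k)))
      ∎
    where
    T : Vector Carrier (suc (suc b))
    T i = sum {toℕ i} (λ j → h (suc (toℕ j)) (toℕ i ℕ.∸ suc (toℕ j)))

  private
    slice : ∀ {b} → Vec ℕ n → (Vec ℕ (suc n) → Carrier) → Vector Carrier (suc b)
    slice bs f i = ∑≤ bs (f ∘ (toℕ i ∷_))

  ∑≤-cong : (b : Vec ℕ n) {f g : Vec ℕ n → Carrier} →
            (∀ a → a ≤ᵛ b → f a ≈ g a) → ∑≤ b f ≈ ∑≤ b g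
  ∑≤-cong []       f≈g = f≈g [] []
  ∑≤-cong (b ∷ bs) f≈g = sum-cong-≋ {suc b} λ i →
    ∑≤-cong bs λ a a≤bs → f≈g _ (ℕ.s≤s⁻¹ (Fin.toℕ<n i) ∷ a≤bs)

  ∑≤-zero : (b : Vec ℕ n) {f : Vec ℕ n → Carrier} →
            (∀ a → a ≤ᵛ b → f a ≈ 0#) → ∑≤ b f ≈ 0#
  ∑≤-zero []       f≈0 = f≈0 [] []
  ∑≤-zero (b ∷ bs) f≈0 = sum-zero {suc b} _ λ i →
    ∑≤-zero bs λ a a≤bs → f≈0 _ (ℕ.s≤s⁻¹ (Fin.toℕ<n i) ∷ a≤bs)

  ∑≤-+ : (b : Vec ℕ n) (f g : Vec ℕ n → Carrier) →
         ∑≤ b (λ a → f a + g a) ≈ ∑≤ b f + ∑≤ b g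
  ∑≤-+ []       f g = refl
  ∑≤-+ (b ∷ bs) f g = trans
    (sum-cong-≋ {suc b} λ i → ∑≤-+ bs (f ∘ (toℕ i ∷_)) (g ∘ (toℕ i ∷_)))
    (∑-distrib-+ {suc b} (slice bs f) (slice bs g))

  *-distribˡ-∑≤ : ∀ x (b : Vec ℕ n) (f : Vec ℕ n → Carrier) →
                  x * ∑≤ b f ≈ ∑≤ b (λ a → x * f a)
  *-distribˡ-∑≤ x []       f = refl
  *-distribˡ-∑≤ x (b ∷ bs) f = trans (*-distribˡ-sum {suc b} x (slice bs f))
    (sum-cong-≋ {suc b} λ i → *-distribˡ-∑≤ x bs (f ∘ (toℕ i ∷_)))

  *-distribʳ-∑≤ : ∀ x (b : Vec ℕ n) (f : Vec ℕ n → Carrier) →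
                  ∑≤ b f * x ≈ ∑≤ b (λ a → f a * x)
  *-distribʳ-∑≤ x []       f = refl
  *-distribʳ-∑≤ x (b ∷ bs) f = trans (*-distribʳ-sum {suc b} x (slice bs f))
    (sum-cong-≋ {suc b} λ i → *-distribʳ-∑≤ x bs (f ∘ (toℕ i ∷_)))

  ∑≤-sum-swap : (b : Vec ℕ n) (f : Vec ℕ n → Fin k → Carrier) →
                ∑≤ b (λ a → sum (f a)) ≈ sum (λ j → ∑≤ b (λ a → f a j))
  ∑≤-sum-swap []       f = refl
  ∑≤-sum-swap (b ∷ bs) f = trans
    (sum-cong-≋ {suc b} λ i → ∑≤-sum-swap bs (f ∘ (toℕ i ∷_)))
    (∑-comm {suc b} λ i j → ∑≤ bs (λ a → f (toℕ i ∷ a) j))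

  ∑≤-swap : (b : Vec ℕ n) (d : Vec ℕ k) (f : Vec ℕ n → Vec ℕ k → Carrier) →
            ∑≤ b (λ a → ∑≤ d (f a)) ≈ ∑≤ d (λ e → ∑≤ b (λ a → f a e))
  ∑≤-swap b []       f = refl
  ∑≤-swap b (d ∷ ds) f = trans
    (∑≤-sum-swap b λ a (i : Fin (suc d)) → ∑≤ ds (λ e → f a (toℕ i ∷ e)))
    (sum-cong-≋ {suc d} λ i → ∑≤-swap b ds (λ a e → f a (toℕ i ∷ e)))

  ∑≤-single : (b : Vec ℕ n) (f : Vec ℕ n → Carrier) {a : Vec ℕ n} → a ≤ᵛ b →
              (∀ e → e ≤ᵛ b → e ≢ a → f e ≈ 0#) → ∑≤ b f ≈ f a
  ∑≤-single []       f []                        f≈0 = refl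
  ∑≤-single (b ∷ bs) f {a ∷ as} (a≤b ∷ as≤bs) f≈0 = begin
    ∑≤ (b ∷ bs) f
      ≈⟨ sum-single {suc b} _ i (λ j j≢i → ∑≤-zero bs λ e e≤bs →
           f≈0 _ (ℕ.s≤s⁻¹ (Fin.toℕ<n j) ∷ e≤bs)
             λ eq → j≢i (Fin.toℕ-injective (≡.trans (∷-injectiveˡ eq) (≡.sym i≡a)))) ⟩
    ∑≤ bs (f ∘ (toℕ i ∷_))
      ≡⟨ ≡.cong (λ z → ∑≤ bs (f ∘ (z ∷_))) i≡a ⟩
    ∑≤ bs (f ∘ (a ∷_))
      ≈⟨ ∑≤-single bs _ as≤bs (λ e e≤bs e≢as → f≈0 _ (a≤b ∷ e≤bs) (e≢as ∘ ∷-injectiveʳ)) ⟩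
    f (a ∷ as) ∎
    where
    i : Fin (suc b)
    i = fromℕ< (s≤s a≤b)
    i≡a : toℕ i ≡ a
    i≡a = Fin.toℕ-fromℕ< (s≤s a≤b)

  private
    keep erase : Vec ℕ n → (Vec ℕ n → Carrier) → Vec ℕ n → Carrier
    keep  a f e = if does (e ≟ᵛ a) then f e else 0#
    erase a f e = if does (e ≟ᵛ a) then 0# else f e

    keep-≡ : ∀ (a : Vec ℕ n) f → keep a f a ≡ f a
    keep-≡ a f rewrite dec-true (a ≟ᵛ a) ≡.refl = ≡.refl

    keep-≢ : ∀ {a e : Vec ℕ n} f → e ≢ a → keep a f e ≡ 0#
    keep-≢ {a = a} {e} f e≢a rewrite dec-false (e ≟ᵛ a) e≢a = ≡.refl

    erase-≢ : ∀ {a e : Vec ℕ n} f → e ≢ a → erase a f e ≡ f e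
    erase-≢ {a = a} {e} f e≢a rewrite dec-false (e ≟ᵛ a) e≢a = ≡.refl

    keep+erase : ∀ (a : Vec ℕ n) f e → f e ≈ keep a f e + erase a f e
    keep+erase a f e with e ≟ᵛ a
    ... | yes _ = sym (+-identityʳ _)
    ... | no  _ = sym (+-identityˡ _)

  -- Splitting `f` into its part at `a` and the rest removes one listed exponent at a time; `Unique`
  -- ensures that erasing `a` leaves the other listed values intact. Later this reduces the value of
  -- [ℓ] to four terms.
  ∑≤-support : (b : Vec ℕ n) (f : Vec ℕ n → Carrier) (as : List (Vec ℕ n)) →
               Unique as → ListAll.All (_≤ᵛ b) as →
               (∀ e → e ≤ᵛ b → e ∉ as → f e ≈ 0#) →
               ∑≤ b f ≈ List.foldr _+_ 0# (List.map f as)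
  ∑≤-support b f [] [] [] f≈0 = ∑≤-zero b λ e e≤b → f≈0 e e≤b λ ()
  ∑≤-support b f (a ∷ as) (a∉as ∷ unique) (a≤b ∷ as≤b) f≈0 = begin
    ∑≤ b f                              ≈⟨ ∑≤-cong b (λ e _ → keep+erase a f e) ⟩
    ∑≤ b (λ e → keep a f e + erase a f e) ≈⟨ ∑≤-+ b (keep a f) (erase a f) ⟩
    ∑≤ b (keep a f) + ∑≤ b (erase a f)
      ≈⟨ +-cong (∑≤-single b (keep a f) a≤b λ e _ e≢a → reflexive (keep-≢ f e≢a))
                (∑≤-support b (erase a f) as unique as≤b rest≈0) ⟩
    keep a f a + List.foldr _+_ 0# (List.map (erase a f) as)
      ≈⟨ +-cong (reflexive (keep-≡ a f)) (unerase as a∉as) ⟩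
    f a + List.foldr _+_ 0# (List.map f as) ∎
    where
    rest≈0 : ∀ e → e ≤ᵛ b → e ∉ as → erase a f e ≈ 0#
    rest≈0 e e≤b e∉as with e ≟ᵛ a
    ... | yes _  = refl
    ... | no e≢a = f≈0 e e≤b λ { (here e≡a) → e≢a e≡a ; (there e∈as) → e∉as e∈as }
    unerase : ∀ es → ListAll.All (a ≢_) es →
              List.foldr _+_ 0# (List.map (erase a f) es) ≈ List.foldr _+_ 0# (List.map f es)
    unerase []       []           = refl
    unerase (e ∷ es) (a≢e ∷ a∉es) =
      +-cong (reflexive (erase-≢ f (a≢e ∘ ≡.sym))) (unerase es a∉es)

  ∑≤-extend : {b d : Vec ℕ n} (f : Vec ℕ n → Carrier) → b ≤ᵛ d →
              (∀ a → ¬ a ≤ᵛ b → f a ≈ 0#) → ∑≤ b f ≈ ∑≤ d f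
  ∑≤-extend f [] f≈0 = refl
  ∑≤-extend {b = b ∷ bs} {d ∷ ds} f (b≤d ∷ bs≤ds) f≈0 = begin
    sum {suc b} (λ i → ∑≤ bs (f ∘ (toℕ i ∷_)))
      ≈⟨ sum-cong-≋ {suc b} (λ i → ∑≤-extend (f ∘ (toℕ i ∷_)) bs≤ds
           λ a a≰bs → f≈0 (toℕ i ∷ a) (a≰bs ∘ Pointwise.tail)) ⟩
    sum {suc b} (λ i → ∑≤ ds (f ∘ (toℕ i ∷_)))
      ≈⟨ sum-extend (λ i → ∑≤ ds (f ∘ (i ∷_))) (s≤s b≤d)
           (λ i b<i → ∑≤-zero ds λ a _ → f≈0 _ λ { (i≤b ∷ _) → ℕ.<⇒≱ b<i i≤b }) ⟩
    sum {suc d} (λ i → ∑≤ ds (f ∘ (toℕ i ∷_))) ∎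

  -- The rearrangement behind the Cauchy product: pairs of exponents are sorted by their sum or by
  -- their first member. `sum-triangle` treats one coordinate, induction the others.
  ∑≤-triangle : (b : Vec ℕ n) (h : Vec ℕ n → Vec ℕ n → Carrier) →
                ∑≤ b (λ e → ∑≤ e (λ a → h a (e ∸ᵛ a))) ≈
                ∑≤ b (λ a → ∑≤ (b ∸ᵛ a) (h a))
  ∑≤-triangle []       h = refl
  ∑≤-triangle (b ∷ bs) h = begin
    sum {suc b} (λ i → ∑≤ bs (λ e → sum {suc (toℕ i)} (λ j →
      ∑≤ e (λ a → h (toℕ j ∷ a) (toℕ i ℕ.∸ toℕ j ∷ (e ∸ᵛ a))))))
      ≈⟨ sum-cong-≋ {suc b} (λ i → ∑≤-sum-swap bs λ e (j : Fin (suc (toℕ i))) →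
           ∑≤ e (λ a → h (toℕ j ∷ a) (toℕ i ℕ.∸ toℕ j ∷ (e ∸ᵛ a)))) ⟩
    sum {suc b} (λ i → sum {suc (toℕ i)} (λ j → ∑≤ bs (λ e →
      ∑≤ e (λ a → h (toℕ j ∷ a) (toℕ i ℕ.∸ toℕ j ∷ (e ∸ᵛ a))))))
      ≈⟨ sum-cong-≋ {suc b} (λ i → sum-cong-≋ {suc (toℕ i)} λ j →
           ∑≤-triangle bs λ a e → h (toℕ j ∷ a) (toℕ i ℕ.∸ toℕ j ∷ e)) ⟩
    sum {suc b} (λ i → sum {suc (toℕ i)} (λ j → H (toℕ j) (toℕ i ℕ.∸ toℕ j)))
      ≈⟨ sum-triangle b H ⟩
    sum {suc b} (λ j → sum {suc (b ℕ.∸ toℕ j)} (λ k → H (toℕ j) (toℕ k)))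
      ≈⟨ sum-cong-≋ {suc b} (λ j → ∑≤-sum-swap bs λ a (k : Fin (suc (b ℕ.∸ toℕ j))) →
           ∑≤ (bs ∸ᵛ a) (λ e → h (toℕ j ∷ a) (toℕ k ∷ e))) ⟨
    sum {suc b} (λ j → ∑≤ bs (λ a → sum {suc (b ℕ.∸ toℕ j)} (λ k →
      ∑≤ (bs ∸ᵛ a) (λ e → h (toℕ j ∷ a) (toℕ k ∷ e))))) ∎
    where
    H : ℕ → ℕ → Carrier
    H j k = ∑≤ bs (λ a → ∑≤ (bs ∸ᵛ a) (λ e → h (j ∷ a) (k ∷ e)))

-- Evaluation of power series at nilpotent points

unit : Fin n → Vec ℕ n
unit {n} j = replicate n 0 [ j ]≔ 1

infixl 6 _+ᵛ_

_+ᵛ_ : ∀ {n} → Vec ℕ n → Vec ℕ n → Vec ℕ n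
_+ᵛ_ = zipWith ℕ._+_

+ᵛ-∸ᵛ : {a e : Vec ℕ n} → a ≤ᵛ e → a +ᵛ (e ∸ᵛ a) ≡ e
+ᵛ-∸ᵛ []          = ≡.refl
+ᵛ-∸ᵛ (a≤e ∷ as≤es) = ≡.cong₂ _∷_ (ℕ.m+[n∸m]≡n a≤e) (+ᵛ-∸ᵛ as≤es)

degree-+ᵛ : (a e : Vec ℕ n) → degree (a +ᵛ e) ≡ degree a ℕ.+ degree e
degree-+ᵛ []       []       = ≡.refl
degree-+ᵛ (a ∷ as) (e ∷ es) = ≡.trans (≡.cong (a ℕ.+ e ℕ.+_) (degree-+ᵛ as es))
  (interchange a e (degree as) (degree es))
  where open CommutativeSemigroupProperties ℕ.+-commutativeSemigroup using (interchange)

degree-∸ᵛ : {a e : Vec ℕ n} → a ≤ᵛ e → degree a ℕ.+ degree (e ∸ᵛ a) ≡ degree e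
degree-∸ᵛ {a = a} {e} a≤e =
  ≡.trans (≡.sym (degree-+ᵛ a (e ∸ᵛ a))) (≡.cong degree (+ᵛ-∸ᵛ a≤e))

degree≤⇒≤ᵛ : ∀ {N} (a : Vec ℕ n) → degree a ≤ N → a ≤ᵛ replicate n N
degree≤⇒≤ᵛ []       _ = []
degree≤⇒≤ᵛ (a ∷ as) h =
  ℕ.≤-trans (ℕ.m≤m+n a _) h ∷ degree≤⇒≤ᵛ as (ℕ.≤-trans (ℕ.m≤n+m _ a) h)

degree-mono : {a e : Vec ℕ n} → a ≤ᵛ e → degree a ≤ degree e
degree-mono []              = z≤n
degree-mono (a≤e ∷ as≤es) = ℕ.+-mono-≤ a≤e (degree-mono as≤es)

degree-replicate : ∀ n N → degree (replicate n N) ≡ n ℕ.* N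
degree-replicate zero    N = ≡.refl
degree-replicate (suc n) N = ≡.cong (N ℕ.+_) (degree-replicate n N)

degree≡0 : (a : Vec ℕ n) → degree a ≡ 0 → a ≡ replicate n 0
degree≡0 []          _ = ≡.refl
degree≡0 (zero ∷ as) h = ≡.cong (0 ∷_) (degree≡0 as h)

degree-unit : (i : Fin n) → degree (unit i) ≡ 1
degree-unit {suc n} zero    = ≡.cong suc (≡.trans (degree-replicate n 0) (ℕ.*-zeroʳ n))
degree-unit {suc n} (suc i) = degree-unit i

∸ᵛ≤ : (b a : Vec ℕ n) → b ∸ᵛ a ≤ᵛ b
∸ᵛ≤ []       []       = []
∸ᵛ≤ (b ∷ bs) (a ∷ as) = ℕ.m∸n≤m b a ∷ ∸ᵛ≤ bs as

replicate-mono : ∀ n {k l} → k ≤ l → replicate n k ≤ᵛ replicate n l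
replicate-mono zero    k≤l = []
replicate-mono (suc n) k≤l = k≤l ∷ replicate-mono n k≤l

degree-sum≤⇒≤ᵛ∸ : ∀ {N} (a e : Vec ℕ n) → degree a ℕ.+ degree e ≤ N →
                  e ≤ᵛ replicate n N ∸ᵛ a
degree-sum≤⇒≤ᵛ∸ []       []       h = []
degree-sum≤⇒≤ᵛ∸ {N = N} (a ∷ as) (e ∷ es) h =
  ℕ.m+n≤o⇒m≤o∸n e (≡.subst (_≤ N) (ℕ.+-comm a e)
    (ℕ.≤-trans (ℕ.+-mono-≤ (ℕ.m≤m+n a _) (ℕ.m≤m+n e _)) h)) ∷
  degree-sum≤⇒≤ᵛ∸ as es (ℕ.≤-trans (ℕ.+-mono-≤ (ℕ.m≤n+m _ a) (ℕ.m≤n+m _ e)) h)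

module SeriesOrder {c ℓ} (R : CommutativeRing c ℓ) where

  open CommutativeRing R hiding (zero) renaming (_*_ to _*R_)
  open PowerSeries (Semiring.rawSemiring semiring) hiding (degree; _+_)
  open BoxSums R

  mono-≢ : ∀ {a e : Vec ℕ n} → e ≢ a → mono a e ≈ 0#
  mono-≢ {a = a} {e} e≢a rewrite dec-false (e ≟ᵛ a) e≢a = refl

  mono-refl : ∀ (a : Vec ℕ n) → mono a a ≈ 1#
  mono-refl a rewrite dec-true (a ≟ᵛ a) ≡.refl = refl

  OrderAtLeast : ℕ → Series n → Set ℓ
  OrderAtLeast k f = ∀ e → degree e < k → f e ≈ 0#

  orderAtLeast-1 : ∀ {f : Series n} → f (replicate n 0) ≈ 0# → OrderAtLeast 1 f
  orderAtLeast-1 f₀≈0 e deg<1 =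
    trans (reflexive (≡.cong _ (degree≡0 e (ℕ.n<1⇒n≡0 deg<1)))) f₀≈0

  orderAtLeast-* : ∀ {j k} {f g : Series n} → OrderAtLeast j f → OrderAtLeast k g →
                   OrderAtLeast (j ℕ.+ k) (f * g)
  orderAtLeast-* {j = j} {k} {f} {g} f≥j g≥k e e<j+k = ∑≤-zero e λ a a≤e → term a a≤e
    where
    term : ∀ a → a ≤ᵛ e → f a *R g (e ∸ᵛ a) ≈ 0#
    term a a≤e with degree a ℕ.<? j
    ... | yes a<j = trans (*-congʳ (f≥j a a<j)) (zeroˡ _)
    ... | no  a≮j = trans (*-congˡ (g≥k (e ∸ᵛ a) (ℕ.+-cancelˡ-< j _ _ (ℕ.≤-<-trans
      (ℕ.≤-trans (ℕ.+-monoˡ-≤ _ (ℕ.≮⇒≥ a≮j)) (ℕ.≤-reflexive (degree-∸ᵛ a≤e))) e<j+k)))) (zeroʳ _)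

  orderAtLeast-^ : ∀ {f : Series n} → OrderAtLeast 1 f → ∀ k → OrderAtLeast k (f Σ.^ k)
  orderAtLeast-^ f≥1 zero    e ()
  orderAtLeast-^ {f = f} f≥1 (suc k) =
    orderAtLeast-* {j = 1} {k} {f} {f Σ.^ k} f≥1 (orderAtLeast-^ f≥1 k)

  -- This is why the finite box in the definition of substitution loses nothing: gᵃ has no
  -- coefficient at e as soon as |a| > |e|.
  orderAtLeast-^^ : ∀ {g : Vector (Series n) m} → (∀ i → OrderAtLeast 1 (g i)) →
                    ∀ a → OrderAtLeast (degree a) (g Σ.^^ a)
  orderAtLeast-^^ g≥1 []       e ()
  orderAtLeast-^^ {g = g} g≥1 (a ∷ as) =
    orderAtLeast-* {j = a} {degree as} {g zero Σ.^ a} {(g ∘ suc) Σ.^^ as}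
      (orderAtLeast-^ (g≥1 zero) a) (orderAtLeast-^^ (g≥1 ∘ suc) as)

module Evaluation {c₁ ℓ₁ c₂ ℓ₂} (R : CommutativeRing c₁ ℓ₁) (S : CommutativeRing c₂ ℓ₂)
  (φ : CommutativeRing.Carrier R → CommutativeRing.Carrier S)
  (φ-isHomomorphism : SemiringMorphisms.IsSemiringHomomorphism
     (Semiring.rawSemiring (CommutativeRing.semiring R))
     (Semiring.rawSemiring (CommutativeRing.semiring S)) φ)
  where

  private module R = CommutativeRing R
  open CommutativeRing S hiding (zero)
  open Monomials (Semiring.rawSemiring semiring)
  private module P = PowerSeries (Semiring.rawSemiring R.semiring)
  open P using (Series; X; mono; _⟪_⟫; module Σ)
  open SemiringMorphisms.IsSemiringHomomorphism φ-isHomomorphism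
  open BoxSums S
  open SeriesOrder R
  open CommutativeMonoidSum +-commutativeMonoid using (sum-cong-≋)
  open Exp semiring using (^-homo-*; ^-congˡ)
  open CommutativeSemigroupProperties *-commutativeSemigroup using (interchange)
  open import Relation.Binary.Reasoning.Setoid setoid

  ^^-cong : {x y : Vector Carrier n} → (∀ i → x i ≈ y i) → ∀ a → x ^^ a ≈ y ^^ a
  ^^-cong x≈y []       = refl
  ^^-cong x≈y (a ∷ as) = *-cong (^-congˡ a (x≈y zero)) (^^-cong (x≈y ∘ suc) as)

  ^^-zero : (x : Vector Carrier n) → x ^^ replicate n 0 ≈ 1#
  ^^-zero {zero}  x = refl
  ^^-zero {suc n} x = trans (*-identityˡ _) (^^-zero (x ∘ suc))

  ^^-unit : (x : Vector Carrier n) (i : Fin n) → x ^^ unit i ≈ x i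
  ^^-unit x zero    = trans (*-cong (*-identityʳ _) (^^-zero (x ∘ suc))) (*-identityʳ _)
  ^^-unit x (suc i) = trans (*-identityˡ _) (^^-unit (x ∘ suc) i)

  ^^-+ᵛ : (x : Vector Carrier n) (a e : Vec ℕ n) → x ^^ (a +ᵛ e) ≈ x ^^ a * x ^^ e
  ^^-+ᵛ x []       []       = sym (*-identityˡ _)
  ^^-+ᵛ x (a ∷ as) (e ∷ es) = trans
    (*-cong (^-homo-* (x zero) a e) (^^-+ᵛ (x ∘ suc) as es)) (interchange _ _ _ _)

  φ-sum : (t : Vector R.Carrier n) →
          φ (Monomials.sum (Semiring.rawSemiring R.semiring) t) ≈ sum (φ ∘ t)
  φ-sum {zero}  t = 0#-homo
  φ-sum {suc n} t = trans (+-homo _ _) (+-congˡ (φ-sum (t ∘ suc)))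

  φ-∑≤ : (b : Vec ℕ n) (f : Vec ℕ n → R.Carrier) →
         φ (Monomials.∑≤ (Semiring.rawSemiring R.semiring) b f) ≈ ∑≤ b (φ ∘ f)
  φ-∑≤ []       f = refl
  φ-∑≤ (b ∷ bs) f = trans
    (φ-sum {suc b} λ i → Monomials.∑≤ (Semiring.rawSemiring R.semiring) bs (f ∘ (toℕ i ∷_)))
    (sum-cong-≋ {suc b} λ i → φ-∑≤ bs (f ∘ (toℕ i ∷_)))

  φ≈0 : ∀ {r} → r R.≈ R.0# → φ r ≈ 0#
  φ≈0 r≈0 = trans (⟦⟧-cong r≈0) 0#-homo

  -- At a point where all monomials of degree at least D vanish, a box of side N ≥ D contains every
  -- monomial that matters. The truncation is then exact, and hence compatible with products and
  -- substitution.
  eval : ℕ → Vector Carrier n → Series n → Carrier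
  eval {n} N x f = ∑≤ (replicate n N) (λ a → φ (f a) * x ^^ a)

  eval-congˡ : ∀ {N} {x y : Vector Carrier n} (f : Series n) →
               (∀ i → x i ≈ y i) → eval N x f ≈ eval N y f
  eval-congˡ {n} f x≈y = ∑≤-cong (replicate n _) λ a _ → *-congˡ (^^-cong x≈y a)

  eval-congʳ : ∀ {N} {x : Vector Carrier n} {f g : Series n} →
               (∀ e → φ (f e) * x ^^ e ≈ φ (g e) * x ^^ e) → eval N x f ≈ eval N x g
  eval-congʳ {n} f≈g = ∑≤-cong (replicate n _) λ a _ → f≈g a

  eval-+ : ∀ N (x : Vector Carrier n) (f g : Series n) →
           eval N x (f P.+ g) ≈ eval N x f + eval N x g
  eval-+ {n} N x f g = trans
    (∑≤-cong (replicate n N) λ a _ → trans (*-congʳ (+-homo (f a) (g a))) (distribʳ _ _ _))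
    (∑≤-+ (replicate n N) (λ a → φ (f a) * x ^^ a) (λ a → φ (g a) * x ^^ a))

  eval-mono : ∀ {N} (x : Vector Carrier n) {a : Vec ℕ n} → a ≤ᵛ replicate n N →
              eval N x (mono a) ≈ x ^^ a
  eval-mono x {a} a≤N = trans
    (∑≤-single _ _ a≤N λ e _ e≢a → trans (*-congʳ (φ≈0 (mono-≢ e≢a))) (zeroˡ _))
    (trans (*-congʳ (trans (⟦⟧-cong (mono-refl a)) 1#-homo)) (*-identityˡ _))

  eval-1 : ∀ {N} (x : Vector Carrier n) → eval N x (mono (replicate n 0)) ≈ 1#
  eval-1 x = trans (eval-mono x (0≤ᵛ _)) (^^-zero x)

  eval-X : ∀ {N} (x : Vector Carrier n) i → 1 ≤ N → eval N x (X i) ≈ x i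
  eval-X {n} x i 1≤N = trans
    (eval-mono x (degree≤⇒≤ᵛ _ (ℕ.≤-trans (ℕ.≤-reflexive (degree-unit i)) 1≤N)))
    (^^-unit x i)

  Nilpotent : ℕ → Vector Carrier n → Set ℓ₂
  Nilpotent D x = ∀ a → D ≤ degree a → x ^^ a ≈ 0#

  module _ {m} {x : Vector Carrier m} {D N} (nilpotent : Nilpotent D x) (D≤N : D ≤ N) where

    -- Multiplying out and rearranging gives the pairs (a, e) with a + e in the box. The pairs still
    -- missing from the full product have |a + e| > N ≥ D, and their monomials vanish at x.
    eval-* : ∀ (f g : Series m) → eval N x (f P.* g) ≈ eval N x f * eval N x g
    eval-* f g = begin
      ∑≤ B (λ e → φ ((f P.* g) e) * x ^^ e)
        ≈⟨ ∑≤-cong B (λ e _ → trans (*-congʳ (φ-∑≤ e _)) (*-distribʳ-∑≤ _ e _)) ⟩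
      ∑≤ B (λ e → ∑≤ e (λ a → φ (f a R.* g (e ∸ᵛ a)) * x ^^ e))
        ≈⟨ ∑≤-cong B (λ e _ → ∑≤-cong e λ a a≤e → split a e a≤e) ⟩
      ∑≤ B (λ e → ∑≤ e (λ a → term f a * term g (e ∸ᵛ a)))
        ≈⟨ ∑≤-triangle B (λ a e → term f a * term g e) ⟩
      ∑≤ B (λ a → ∑≤ (B ∸ᵛ a) (λ e → term f a * term g e))
        ≈⟨ ∑≤-cong B (λ a _ → ∑≤-extend _ (∸ᵛ≤ B a) λ e → outside a e) ⟩
      ∑≤ B (λ a → ∑≤ B (λ e → term f a * term g e))
        ≈⟨ ∑≤-cong B (λ a _ → *-distribˡ-∑≤ (term f a) B (term g)) ⟨
      ∑≤ B (λ a → term f a * eval N x g)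
        ≈⟨ *-distribʳ-∑≤ (eval N x g) B (term f) ⟨
      eval N x f * eval N x g ∎
      where
      B : Vec ℕ m
      B = replicate m N
      term : Series m → Vec ℕ m → Carrier
      term h a = φ (h a) * x ^^ a
      split : ∀ a e → a ≤ᵛ e →
              φ (f a R.* g (e ∸ᵛ a)) * x ^^ e ≈ term f a * term g (e ∸ᵛ a)
      split a e a≤e = trans
        (*-cong (*-homo _ _)
          (trans (reflexive (≡.cong (x ^^_) (≡.sym (+ᵛ-∸ᵛ a≤e)))) (^^-+ᵛ x a (e ∸ᵛ a))))
        (interchange _ _ _ _)
      outside : ∀ a e → ¬ e ≤ᵛ B ∸ᵛ a → term f a * term g e ≈ 0#
      outside a e e≰B∸a = trans (interchange _ _ _ _) (trans
        (*-congˡ (trans (sym (^^-+ᵛ x a e)) (nilpotent (a +ᵛ e) D≤deg))) (zeroʳ _))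
        where
        D≤deg : D ≤ degree (a +ᵛ e)
        D≤deg = ℕ.≤-trans D≤N (ℕ.<⇒≤ (ℕ.≰⇒> λ deg≤N → e≰B∸a
          (degree-sum≤⇒≤ᵛ∸ a e (≡.subst (_≤ N) (degree-+ᵛ a e) deg≤N))))

    eval-^ : ∀ (f : Series m) k → eval N x (f Σ.^ k) ≈ eval N x f ^ k
    eval-^ f zero    = eval-1 x
    eval-^ f (suc k) = trans (eval-* f (f Σ.^ k)) (*-congˡ (eval-^ f k))

    eval-^^ : ∀ {n} (g : Vector (Series m) n) a →
              eval N x (g Σ.^^ a) ≈ (λ i → eval N x (g i)) ^^ a
    eval-^^ g []       = eval-1 x
    eval-^^ g (a ∷ as) = trans (eval-* (g zero Σ.^ a) ((g ∘ suc) Σ.^^ as))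
      (*-cong (eval-^ (g zero) a) (eval-^^ (g ∘ suc) as))

    -- A monomial of degree at most mN occurs in gᵃ only for |a| ≤ mN, so the box
    -- of side N′ contains all contributing exponents a.
    eval-⟪⟫ : ∀ {n} (f : Series n) (g : Vector (Series m) n) →
              (∀ i → g i (replicate m 0) R.≈ R.0#) → ∀ {N′} → m ℕ.* N ≤ N′ →
              eval N x (f ⟪ g ⟫) ≈ eval N′ (λ i → eval N x (g i)) f
    eval-⟪⟫ {n} f g g₀≈0 {N′} mN≤N′ = begin
      ∑≤ B (λ e → φ ((f ⟪ g ⟫) e) * x ^^ e)
        ≈⟨ ∑≤-cong B (λ e _ → *-congʳ (φ-∑≤ (replicate n (degree e)) _)) ⟩
      ∑≤ B (λ e → ∑≤ (replicate n (degree e)) (λ a → φ (f a R.* (g Σ.^^ a) e)) * x ^^ e)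
        ≈⟨ ∑≤-cong B (λ e e≤B → *-congʳ (∑≤-extend _ (bound e e≤B) (outside e))) ⟩
      ∑≤ B (λ e → ∑≤ B′ (λ a → φ (f a R.* (g Σ.^^ a) e)) * x ^^ e)
        ≈⟨ ∑≤-cong B (λ e _ → trans (*-distribʳ-∑≤ _ B′ _)
             (∑≤-cong B′ λ a _ → trans (*-congʳ (*-homo _ _)) (*-assoc _ _ _))) ⟩
      ∑≤ B (λ e → ∑≤ B′ (λ a → φ (f a) * (φ ((g Σ.^^ a) e) * x ^^ e)))
        ≈⟨ ∑≤-swap B B′ _ ⟩
      ∑≤ B′ (λ a → ∑≤ B (λ e → φ (f a) * (φ ((g Σ.^^ a) e) * x ^^ e)))
        ≈⟨ ∑≤-cong B′ (λ a _ → *-distribˡ-∑≤ (φ (f a)) B _) ⟨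
      ∑≤ B′ (λ a → φ (f a) * eval N x (g Σ.^^ a))
        ≈⟨ ∑≤-cong B′ (λ a _ → *-congˡ (eval-^^ g a)) ⟩
      eval N′ (λ i → eval N x (g i)) f ∎
      where
      B : Vec ℕ m
      B = replicate m N
      B′ : Vec ℕ n
      B′ = replicate n N′
      bound : ∀ e → e ≤ᵛ B → replicate n (degree e) ≤ᵛ B′
      bound e e≤B = replicate-mono n (ℕ.≤-trans (degree-mono e≤B)
        (ℕ.≤-trans (ℕ.≤-reflexive (degree-replicate m N)) mN≤N′))
      outside : ∀ e a → ¬ a ≤ᵛ replicate n (degree e) → φ (f a R.* (g Σ.^^ a) e) ≈ 0#
      outside e a a≰deg = φ≈0 (R.trans (R.*-congˡ (orderAtLeast-^^ {g = g}
        (λ i → orderAtLeast-1 (g₀≈0 i)) a e (ℕ.≰⇒> (a≰deg ∘ degree≤⇒≤ᵛ a)))) (R.zeroʳ _))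

-- The series [m] and their values at nilpotent points

degree-zeros : ∀ n → degree (replicate n 0) ≡ 0
degree-zeros n = ≡.trans (degree-replicate n 0) (ℕ.*-zeroʳ n)

zeros≢unit : (i : Fin n) → replicate n 0 ≢ unit i
zeros≢unit {n} i eq = ℕ.1+n≢0
  (≡.trans (≡.sym (degree-unit i)) (≡.trans (≡.cong degree (≡.sym eq)) (degree-zeros n)))

module _ {c ℓ} (R : CommutativeRing c ℓ) where

  private
    module R = CommutativeRing R
    module P = PowerSeries (Semiring.rawSemiring R.semiring)
  open SeriesOrder R
  open BoxSums R

  module MultConstant (𝐅 : P.FormalGroupLaw n) where

    open P.FormalGroupLaw 𝐅

    X-zeros : (i : Fin m) → P.X i (replicate m 0) R.≈ R.0#
    X-zeros i = mono-≢ (zeros≢unit i)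

    F-zeros : ∀ i → F i (replicate (n ℕ.+ n) 0) R.≈ R.0#
    F-zeros i = R.trans
      (linear i _ (ℕ.≤-trans (ℕ.≤-reflexive (degree-zeros (n ℕ.+ n))) z≤n))
      (R.trans (R.+-cong (X-zeros (i ↑ˡ n)) (X-zeros (n ↑ʳ i))) (R.+-identityˡ R.0#))

    -- The constant term of a substitution is a sum over the box of side 0, so it involves only the
    -- constant term of F, which `linear` makes zero.
    mult-zeros : ∀ m i → mult m i (replicate n 0) R.≈ R.0#
    mult-zeros zero          i = R.refl
    mult-zeros (suc zero)    i = X-zeros i
    mult-zeros (suc (suc m)) i = ∑≤-zero _ λ a a≤0 → R.trans
      (R.*-congʳ (R.trans (R.reflexive (≡.cong (F i) (degree≡0 a (deg≡0 a≤0)))) (F-zeros i)))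
      (R.zeroˡ _)
      where
      deg≡0 : ∀ {a} → a ≤ᵛ replicate (n ℕ.+ n) (degree (replicate n 0)) → degree a ≡ 0
      deg≡0 {a} a≤0 = ℕ.n≤0⇒n≡0 (ℕ.≤-trans (degree-mono a≤0) (ℕ.≤-reflexive
        (≡.trans (≡.cong (degree ∘ replicate (n ℕ.+ n)) (degree-zeros n)) (degree-zeros (n ℕ.+ n)))))

module MultEvaluation {c₁ ℓ₁ c₂ ℓ₂} (R : CommutativeRing c₁ ℓ₁) (S : CommutativeRing c₂ ℓ₂)
  (φ : CommutativeRing.Carrier R → CommutativeRing.Carrier S)
  (φ-isHomomorphism : SemiringMorphisms.IsSemiringHomomorphism
     (Semiring.rawSemiring (CommutativeRing.semiring R))
     (Semiring.rawSemiring (CommutativeRing.semiring S)) φ)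
  {n} (𝐅 : PowerSeries.FormalGroupLaw (Semiring.rawSemiring (CommutativeRing.semiring R)) n)
  where

  private module R = CommutativeRing R
  open CommutativeRing S hiding (zero)
  open Monomials (Semiring.rawSemiring semiring)
  private module P = PowerSeries (Semiring.rawSemiring R.semiring)
  open import Algebra.Definitions.RawSemiring (Semiring.rawSemiring semiring)
    using () renaming (_×_ to _·_)
  open import Algebra.Properties.Semiring.Exp semiring using (^-homo-*)
  open P.FormalGroupLaw 𝐅
  open Evaluation R S φ φ-isHomomorphism
  open BoxSums S
  open MultConstant R 𝐅
  open CommutativeSemigroupProperties *-commutativeSemigroup using (interchange)
  open import Relation.Binary.Reasoning.Setoid setoid

  module _ {x : Vector Carrier n} {D N} (nilpotent : Nilpotent D x) (D≤N : D ≤ N) (1≤N : 1 ≤ N) where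

    -- The side N′ of the outer box is left free, so that it can be moved past the stage from which
    -- the partial sums of F are stationary.
    eval-mult-suc : ∀ m {y} → (∀ j → eval N x (mult (suc m) j) ≈ y j) →
                    ∀ {N′} → n ℕ.* N ≤ N′ → ∀ i →
                    eval N x (mult (suc (suc m)) i) ≈ eval N′ (x ++ y) (F i)
    eval-mult-suc m {y} evals {N′} nN≤N′ i = trans
      (eval-⟪⟫ nilpotent D≤N (F i) (P.X ++ mult (suc m))
        ++-zeros nN≤N′)
      (eval-congˡ (F i) ++-evals)
      where
      ++-zeros : ∀ k → (P.X ++ mult (suc m)) k (replicate n 0) R.≈ R.0#
      ++-zeros k with splitAt n k
      ... | inj₁ j = X-zeros j
      ... | inj₂ j = mult-zeros (suc m) j
      ++-evals : ∀ k → eval N x ((P.X ++ mult (suc m)) k) ≈ (x ++ y) k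
      ++-evals k with splitAt n k
      ... | inj₁ j = eval-X x j 1≤N
      ... | inj₂ j = evals j

  -- Iterated sums up to the congruence of S, where partial sums become stationary.
  data IteratedSum (x : Vector Carrier n) : ℕ → Vector Carrier n → Set (c₂ ⊔ ℓ₂) where
    single : ∀ {y} → (∀ j → x j ≈ y j) → IteratedSum x 1 y
    extend : ∀ {m y z} → IteratedSum x m y →
             (∀ j → ∃ λ N₀ → ∀ N → N₀ ≤ N → eval N (x ++ y) (F j) ≈ z j) →
             IteratedSum x (suc m) z

  -- Identifies the m-fold sum, built from limits, with the value of the series [m]. Each further
  -- summand is one substitution, evaluated on a box large enough for both the substitution and the
  -- limit.
  eval-mult : ∀ {x : Vector Carrier n} {D N} → Nilpotent D x → D ≤ N → 1 ≤ N →
              ∀ {m y} → IteratedSum x m y → ∀ j → eval N x (mult m j) ≈ y j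
  eval-mult {x} _ _ 1≤N (single x≈y) j = trans (eval-X x j 1≤N) (x≈y j)
  eval-mult {x} {D} {N} nilpotent D≤N 1≤N (extend {suc m} {y} {z} s limit) j = begin
    eval N x (mult (suc (suc m)) j)
      ≈⟨ eval-mult-suc nilpotent D≤N 1≤N m (eval-mult nilpotent D≤N 1≤N s) (ℕ.m≤m+n (n ℕ.* N) N₀) j ⟩
    eval (n ℕ.* N ℕ.+ N₀) (x ++ y) (F j)
      ≈⟨ proj₂ (limit j) (n ℕ.* N ℕ.+ N₀) (ℕ.m≤n+m N₀ (n ℕ.* N)) ⟩
    z j ∎
    where N₀ = proj₁ (limit j)
  eval-mult _ _ _ (extend {zero} () _) j

  eval-F-linear : ∀ {x y : Vector Carrier n} {N} → 1 ≤ N → Nilpotent 2 (x ++ y) → ∀ i →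
                  eval N (x ++ y) (F i) ≈ x i + y i
  eval-F-linear {x} {y} {N} 1≤N nilpotent i = begin
    eval N (x ++ y) (F i)               ≈⟨ eval-congʳ {g = P.X₂ i P.+ P.Y₂ i} term ⟩
    eval N (x ++ y) (P.X₂ i P.+ P.Y₂ i) ≈⟨ eval-+ N (x ++ y) (P.X₂ i) (P.Y₂ i) ⟩
    eval N (x ++ y) (P.X₂ i) + eval N (x ++ y) (P.Y₂ i)
      ≈⟨ +-cong (eval-X (x ++ y) (i ↑ˡ n) 1≤N) (eval-X (x ++ y) (n ↑ʳ i) 1≤N) ⟩
    (x ++ y) (i ↑ˡ n) + (x ++ y) (n ↑ʳ i)
      ≡⟨ ≡.cong₂ _+_ (lookup-++ˡ x y i) (lookup-++ʳ x y i) ⟩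
    x i + y i ∎
    where
    open SemiringMorphisms.IsSemiringHomomorphism φ-isHomomorphism using (⟦⟧-cong)
    term : ∀ e → φ (F i e) * (x ++ y) ^^ e ≈ φ ((P.X₂ i P.+ P.Y₂ i) e) * (x ++ y) ^^ e
    term e with degree e ℕ.≤? 1
    ... | yes deg≤1 = *-congʳ (⟦⟧-cong (linear i e deg≤1))
    ... | no  deg≰1 = trans (vanish (φ (F i e))) (sym (vanish _))
      where
      vanish : ∀ r → r * (x ++ y) ^^ e ≈ 0#
      vanish r = trans (*-congˡ (nilpotent e (ℕ.≰⇒> deg≰1))) (zeroʳ r)

  module SquareZero {π : Carrier} (π²≈0 : π * π ≈ 0#) where

    ^^-scale : ∀ {k} (t : Vector Carrier k) a → (λ i → π * t i) ^^ a ≈ π ^ degree a * t ^^ a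
    ^^-scale t []       = sym (*-identityˡ 1#)
    ^^-scale t (a ∷ as) = begin
      (π * t zero) ^ a * (λ i → π * t (suc i)) ^^ as
        ≈⟨ *-cong (^-distrib-* a) (^^-scale (t ∘ suc) as) ⟩
      (π ^ a * t zero ^ a) * (π ^ degree as * (t ∘ suc) ^^ as)
        ≈⟨ interchange _ _ _ _ ⟩
      (π ^ a * π ^ degree as) * (t zero ^ a * (t ∘ suc) ^^ as)
        ≈⟨ *-congʳ (^-homo-* π a (degree as)) ⟨
      π ^ (a ℕ.+ degree as) * (t zero ^ a * (t ∘ suc) ^^ as) ∎
      where
      ^-distrib-* : ∀ k → (π * t zero) ^ k ≈ π ^ k * t zero ^ k
      ^-distrib-* zero    = sym (*-identityˡ 1#)
      ^-distrib-* (suc k) = trans (*-congˡ (^-distrib-* k)) (interchange _ _ _ _)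

    nilpotent-scale : ∀ {k} {z : Vector Carrier k} (t : Vector Carrier k) →
                      (∀ i → z i ≈ π * t i) → Nilpotent 2 z
    nilpotent-scale {z = z} t z≈πt a 2≤deg = begin
      z ^^ a                   ≈⟨ ^^-cong z≈πt a ⟩
      (λ i → π * t i) ^^ a     ≈⟨ ^^-scale t a ⟩
      π ^ degree a * t ^^ a    ≈⟨ *-congʳ (π^≈0 2≤deg) ⟩
      0# * t ^^ a              ≈⟨ zeroˡ _ ⟩
      0#                       ∎
      where
      π^≈0 : ∀ {k} → 2 ≤ k → π ^ k ≈ 0#
      π^≈0 (s≤s (s≤s {n = k} _)) =
        trans (sym (*-assoc π π _)) (trans (*-congʳ π²≈0) (zeroˡ _))

    -- On multiples of a square-zero element the group law is plain addition, so [m] acts as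
    -- multiplication by m.
    eval-mult-linear : ∀ (t : Vector Carrier n) {N} → 2 ≤ N → ∀ m i →
                       eval N (λ j → π * t j) (mult (suc m) i) ≈ π * (suc m · t i)
    eval-mult-linear t {N} 2≤N zero i = trans
      (eval-X (λ j → π * t j) i (ℕ.<⇒≤ 2≤N)) (*-congˡ (sym (+-identityʳ _)))
    eval-mult-linear t {N} 2≤N (suc m) i = begin
      eval N x (mult (suc (suc m)) i)
        ≈⟨ eval-mult-suc (nilpotent-scale t λ _ → refl) 2≤N (ℕ.<⇒≤ 2≤N) m
             (eval-mult-linear t 2≤N m) (ℕ.m≤m+n _ 1) i ⟩
      eval (n ℕ.* N ℕ.+ 1) (x ++ y) (F i)
        ≈⟨ eval-F-linear (ℕ.m≤n+m 1 _) (nilpotent-scale (t ++ λ j → suc m · t j) scaled) i ⟩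
      x i + y i
        ≈⟨ distribˡ π _ _ ⟨
      π * (suc (suc m) · t i) ∎
      where
      x y : Vector Carrier n
      x j = π * t j
      y j = π * (suc m · t j)
      scaled : ∀ k → (x ++ y) k ≈ π * (t ++ λ j → suc m · t j) k
      scaled k with splitAt n k
      ... | inj₁ _ = refl
      ... | inj₂ _ = refl

  eval-unit : ∀ {x : Vector Carrier k} {a N} (f : P.Series k) → degree a ≡ 1 → 1 ≤ N →
              f (replicate k 0) R.≈ R.0# → Nilpotent 2 x →
              (∀ e → degree e ≡ 1 → e ≢ a → x ^^ e ≈ 0#) →
              eval N x f ≈ φ (f a) * x ^^ a
  eval-unit {k = k} {x} {a} {N} f deg-a 1≤N f₀≈0 nilpotent rest≈0 =
    ∑≤-single (replicate k N) (λ e → φ (f e) * x ^^ e)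
      (degree≤⇒≤ᵛ a (ℕ.≤-trans (ℕ.≤-reflexive deg-a) 1≤N)) λ e _ → term e
    where
    term : ∀ e → e ≢ a → φ (f e) * x ^^ e ≈ 0#
    term e e≢a with degree e in eq
    ... | 0 = trans (*-congʳ (φ≈0 (R.trans (R.reflexive (≡.cong f (degree≡0 e eq))) f₀≈0))) (zeroˡ _)
    ... | 1 = trans (*-congˡ (rest≈0 e eq e≢a)) (zeroʳ _)
    ... | suc (suc d) = trans (*-congˡ (nilpotent e
      (ℕ.≤-trans (s≤s (s≤s z≤n)) (ℕ.≤-reflexive (≡.sym eq))))) (zeroʳ _)

-- p-adic integers

∣⇒≈0 : ∀ {x} → + m ℤ.∣ x → x ≈ + 0 [mod m ]
∣⇒≈0 {x = x} m∣x = mod (≡.subst (_ ℤ.∣_) (≡.sym (ℤ.+-identityʳ x)) m∣x)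

≈0⇒∣ : ∀ {x} → x ≈ + 0 [mod m ] → + m ℤ.∣ x
≈0⇒∣ {x = x} (mod m∣x-0) = ≡.subst (_ ℤ.∣_) (ℤ.+-identityʳ x) m∣x-0

≈mod-weaken : ∀ {x y} → m ℕ.∣ n → x ≈ y [mod n ] → x ≈ y [mod m ]
≈mod-weaken m∣n (mod n∣x-y) = mod (ℤ.∣-trans (ℤ.∣ᵤ⇒∣ m∣n) n∣x-y)

≈mod-cancel : ∀ {x y} .{{_ : ℕ.NonZero p}} → + p ℤ.* x ≈ + p ℤ.* y [mod p ℕ.* m ] → x ≈ y [mod m ]
≈mod-cancel {p} {m} {x} {y} (mod d) = mod (ℤ.*-cancelˡ-∣ (+ p)
  (≡.subst₂ ℤ._∣_ (ℤ.pos-* p m) (eq (+ p) x y) d))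
  where
  eq : ∀ p x y → p ℤ.* x ℤ.- p ℤ.* y ≡ p ℤ.* (x ℤ.- y)
  eq = ℤSolver.solve-∀

^-∣-^ : ∀ p {m n} → m ≤ n → p ℕ.^ m ℕ.∣ p ℕ.^ n
^-∣-^ p z≤n       = ℕ.1∣ _
^-∣-^ p (s≤s m≤n) = ℕ.*-monoʳ-∣ p (^-∣-^ p m≤n)

approx-≤ : (a : PAdic p) → m ≤ n → approx a n ≈ approx a m [mod p ℕ.^ m ]
approx-≤ {p} {m} a m≤n = go (ℕ.≤⇒≤′ m≤n)
  where
  go : ∀ {n} → m ℕ.≤′ n → approx a n ≈ approx a m [mod p ℕ.^ m ]
  go (ℕ.≤′-reflexive ≡.refl) = ≡⇒≈mod ≡.refl
  go (ℕ.≤′-step m≤n) =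
    ≈mod-trans (≈mod-weaken (^-∣-^ p (ℕ.≤′⇒≤ m≤n)) (coherent a _)) (go m≤n)

-- Abstract, since unfolding the coherence proof of the quotient is expensive.
abstract
  p-divides : .{{_ : ℕ.NonZero p}} (a : PAdic p) (k : ℕ) →
              approx a (suc k) ≈ + 0 [mod p ℕ.^ suc k ] →
              ∃ λ (w : PAdic p) → (a ≈ₚ (constₚ (+ p) *ₚ w)) × approx w k ≈ + 0 [mod p ℕ.^ k ]
  p-divides {p} a k aₖ≈0 = w , levelwise (λ n → ≈mod-sym (≡.subst
      (_≈ approx a n [mod p ℕ.^ n ]) (a≡pw n) (coherent a n)))
    , ≈mod-cancel {p} {p ℕ.^ k} (≡.subst₂ (_≈_[mod p ℕ.^ suc k ])
        (a≡pw k) (≡.sym (ℤ.*-zeroʳ (+ p))) aₖ≈0)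
    where
    p^1∣p^ : ∀ n → p ℕ.^ 1 ℕ.∣ p ℕ.^ suc n
    p^1∣p^ n = ^-∣-^ p (s≤s (z≤n {n}))
    -- All positive levels agree modulo p with level 1, hence with level `suc k`, which vanishes
    -- modulo p.
    p∣a : ∀ n → + p ℤ.∣ approx a (suc n)
    p∣a n = ≡.subst (λ z → + z ℤ.∣ approx a (suc n)) (ℕ.^-identityʳ p) (≈0⇒∣
      (≈mod-trans (approx-≤ a (s≤s (z≤n {n})))
        (≈mod-trans (≈mod-sym (approx-≤ a (s≤s (z≤n {k})))) (≈mod-weaken (p^1∣p^ k) aₖ≈0))))
    -- Division by p costs one level of precision: level n of the quotient is read off level n + 1
    -- of `a`, and coherence follows by cancelling p.
    q : ℕ → ℤ
    q n = ℤ.quotient (p∣a n)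
    a≡pw : ∀ n → approx a (suc n) ≡ + p ℤ.* q n
    a≡pw n = ≡.trans (ℤ._∣_.equality (p∣a n)) (ℤ.*-comm (q n) (+ p))
    w : PAdic p
    w = padic q λ n → ≈mod-cancel {p} {p ℕ.^ n}
      (≡.subst₂ (_≈_[mod p ℕ.^ suc n ]) (a≡pw (suc n)) (a≡pw n) (coherent a (suc n)))

approx-isHomomorphism : ∀ n → SemiringMorphisms.IsSemiringHomomorphism (rawℤₚ p)
  (rawℤ/p (p ℕ.^ n)) (λ a → approx a n)
approx-isHomomorphism n = record
  { isNearSemiringHomomorphism = record
    { +-isMonoidHomomorphism = record
      { isMagmaHomomorphism = record
        { isRelHomomorphism = record { cong = λ e → at e n }
        ; homo = λ _ _ → ≡⇒≈mod ≡.refl }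
      ; ε-homo = ≡⇒≈mod ≡.refl }
    ; *-homo = λ _ _ → ≡⇒≈mod ≡.refl }
  ; 1#-homo = ≡⇒≈mod ≡.refl }

-- The linear coefficients are read off modulo p² by evaluating [p] modulo p⁴
-- at the points (p², 0) and (0, p²), where all higher monomials vanish.
module LinearCoefficients {p} .{{_ : ℕ.NonZero p}} (𝐅 : PowerSeries.FormalGroupLaw (rawℤₚ p) 2) where

  private module S = CommutativeRing (ℤ/ (p ℕ.^ 4))
  open PowerSeries.FormalGroupLaw 𝐅
  open MultEvaluation (ℤₚ p) (ℤ/ (p ℕ.^ 4)) (λ a → approx a 4) (approx-isHomomorphism 4) 𝐅
  open Evaluation (ℤₚ p) (ℤ/ (p ℕ.^ 4)) (λ a → approx a 4) (approx-isHomomorphism 4)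
  open MultConstant (ℤₚ p) 𝐅
  open Monomials (Semiring.rawSemiring S.semiring) using (_^^_)
  open import Algebra.Definitions.RawSemiring (Semiring.rawSemiring S.semiring)
    using () renaming (_×_ to _·_)

  private
    π : ℤ
    π = + p ℤ.* + p

    p^2≡π : + (p ℕ.^ 2) ≡ π
    p^2≡π = ≡.trans (≡.cong (λ z → + (p ℕ.* z)) (ℕ.*-identityʳ p)) (ℤ.pos-* p p)

    π²≈0 : π ℤ.* π ≈ + 0 [mod p ℕ.^ 4 ]
    π²≈0 = ∣⇒≈0 (ℤ.∣-reflexive (≡.trans (≡.cong +_ (ℕ.^-distribˡ-+-* p 2 2))
      (≡.trans (ℤ.pos-* (p ℕ.^ 2) (p ℕ.^ 2)) (≡.cong₂ ℤ._*_ p^2≡π p^2≡π))))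

  open SquareZero {π} π²≈0

  ·-ℤ : ∀ n x → n · x ≡ + n ℤ.* x
  ·-ℤ zero    x = ≡.sym (ℤ.*-zeroˡ x)
  ·-ℤ (suc n) x = ≡.trans (≡.cong (λ z → x ℤ.+ z) (·-ℤ n x)) (≡.sym (ℤ.suc-* (+ n) x))

  -- Both sides of the evaluated identity carry the factor π = p²; cancelling it from a congruence
  -- modulo p⁴ leaves one modulo p². With this precision the error in the term p xᵢ will have
  -- valuation at least 2 + μ.
  linear-coefficient : (t : Vector ℤ 2) (a : Vec ℕ 2) → degree a ≡ 1 →
    (λ j → π ℤ.* t j) ^^ a ≈ π [mod p ℕ.^ 4 ] →
    (∀ e → degree e ≡ 1 → e ≢ a → (λ j → π ℤ.* t j) ^^ e ≈ + 0 [mod p ℕ.^ 4 ]) →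
    ∀ i → approx (mult p i a) 2 ≈ + p ℤ.* t i [mod p ℕ.^ 2 ]
  linear-coefficient t a deg-a x^a≈π rest≈0 i = ≈mod-trans
    (≈mod-sym (approx-≤ (mult p i a) (s≤s (s≤s (z≤n {2})))))
    (≈mod-cancel {p} (≈mod-cancel {p} (≡.subst₂ (_≈_[mod p ℕ.^ 4 ])
      (ℤ.*-assoc (+ p) (+ p) _)
      (≡.trans (≡.cong (π ℤ.*_) (·-ℤ p (t i))) (ℤ.*-assoc (+ p) (+ p) _)) scaled)))
    where
    x : Vector ℤ 2
    x j = π ℤ.* t j
    evaluated : ∀ q .{{_ : ℕ.NonZero q}} → eval 2 x (mult q i) ≈ π ℤ.* (q · t i) [mod p ℕ.^ 4 ]
    evaluated (suc q) = eval-mult-linear t ℕ.≤-refl q i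
    scaled : π ℤ.* approx (mult p i a) 4 ≈ π ℤ.* (p · t i) [mod p ℕ.^ 4 ]
    scaled = S.trans (S.*-comm π (approx (mult p i a) 4)) (S.trans
      (S.*-congˡ {approx (mult p i a) 4} (S.sym x^a≈π))
      (S.trans (S.sym (eval-unit {x = x} {N = 2} (mult p i) deg-a (s≤s z≤n) (mult-zeros p i)
        (nilpotent-scale t λ _ → S.refl) rest≈0)) (evaluated p)))

  -- `lookup (unit j) i` is the Kronecker delta, so the Jacobian matrix of [p] at the origin is p
  -- times the identity modulo p².
  mult-linear : ∀ i j → approx (mult p i (unit j)) 2 ≈ + p ℤ.* + lookup (unit j) i [mod p ℕ.^ 2 ]
  mult-linear i j = linear-coefficient (λ k → + lookup (unit j) k) (unit j) (degree-unit j)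
    (S.trans (^^-unit (λ k → π ℤ.* + lookup (unit j) k) j) (≡⇒≈mod (πδ≡π j))) (rest j) i
    where
    πδ≡π : ∀ j → π ℤ.* + lookup (unit j) j ≡ π
    πδ≡π 0F = ℤ.*-identityʳ π
    πδ≡π 1F = ℤ.*-identityʳ π
    0^ : ∀ y → π ℤ.* + 0 ℤ.* + 1 ℤ.* y ≈ + 0 [mod p ℕ.^ 4 ]
    0^ y = ≡⇒≈mod (≡.cong (λ z → z ℤ.* + 1 ℤ.* y) (ℤ.*-zeroʳ π))
    rest : ∀ j e → degree e ≡ 1 → e ≢ unit j →
           (λ k → π ℤ.* + lookup (unit j) k) ^^ e ≈ + 0 [mod p ℕ.^ 4 ]
    rest 0F (0 ∷ 1 ∷ []) _ _   = ≡⇒≈mod (≡.trans (ℤ.*-identityˡ _) (≡.trans (ℤ.*-identityʳ _)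
      (≡.trans (ℤ.*-identityʳ _) (ℤ.*-zeroʳ π))))
    rest 0F (1 ∷ 0 ∷ []) _ e≢a = contradiction ≡.refl e≢a
    rest 1F (1 ∷ 0 ∷ []) _ _   = 0^ _
    rest 1F (0 ∷ 1 ∷ []) _ e≢a = contradiction ≡.refl e≢a

-- Height and lowest coefficients

prime-∣-* : Prime p → ∀ {x y} → + p ℤ.∣ x ℤ.* y → + p ℤ.∣ x ⊎ + p ℤ.∣ y
prime-∣-* pp {x} {y} p∣xy = Sum.map ℤ.∣ᵤ⇒∣ ℤ.∣ᵤ⇒∣
  (euclidsLemma ℤ.∣ x ∣ ℤ.∣ y ∣ pp (≡.subst (_ ℕ.∣_) (ℤ.abs-* x y) (ℤ.∣⇒∣ᵤ p∣xy)))

-- Coordinates with respect to a basis matter only up to congruence; a canonical representative in a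
-- finite type makes them countable for the pigeonhole principle.
residue : .{{_ : ℕ.NonZero p}} → ℤ → Fin p
residue {p} x = fromℕ< (n%ℕd<d x p)

residue-injective : .{{_ : ℕ.NonZero p}} → ∀ x y → residue {p} x ≡ residue y → x ≈ y [mod p ]
residue-injective {p} x y eq = ≈mod-trans (reduces x)
  (≈mod-trans (≡⇒≈mod (≡.cong +_ (Fin.fromℕ<-injective _ _ (n%ℕd<d x p) (n%ℕd<d y p) eq)))
    (≈mod-sym (reduces y)))
  where
  cancel : ∀ r s → (r ℤ.+ s) ℤ.- r ≡ s
  cancel = ℤSolver.solve-∀
  reduces : ∀ x → x ≈ + (x %ℕ p) [mod p ]
  reduces x = mod (ℤ.divides (x /ℕ p) (≡.trans
    (≡.cong (ℤ._- + (x %ℕ p)) (a≡a%ℕn+[a/ℕn]*n x p)) (cancel (+ (x %ℕ p)) (x /ℕ p ℤ.* + p))))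

toℕ-injective-mod : (s t : Fin p) → + toℕ s ≈ + toℕ t [mod p ] → s ≡ t
toℕ-injective-mod {p} s t (mod p∣s-t) = Fin.toℕ-injective (ℤ.+-injective
  (ℤ.i-j≡0⇒i≡j (+ toℕ s) (+ toℕ t) (ℤ.∣i∣≡0⇒i≡0 (small (ℤ.∣⇒∣ᵤ p∣s-t) bound))))
  where
  bound : ℤ.∣ + toℕ s ℤ.- + toℕ t ∣ < p
  bound = ℕ.≤-<-trans
    (≡.subst (λ z → ℤ.∣ z ∣ ≤ toℕ s ℕ.⊔ toℕ t) (≡.sym (ℤ.m-n≡m⊖n (toℕ s) (toℕ t)))
      (ℤ.∣m⊝n∣≤m⊔n (toℕ s) (toℕ t)))
    (ℕ.⊔-pres-<m (Fin.toℕ<n s) (Fin.toℕ<n t))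
  small : ∀ {k} → p ℕ.∣ k → k < p → k ≡ 0
  small {zero}  _   _   = ≡.refl
  small {suc k} p∣k k<p = contradiction p∣k (ℕ.>⇒∤ k<p)

funToFin-cong : {f g : Fin m → Fin n} → (∀ i → f i ≡ g i) → funToFin f ≡ funToFin g
funToFin-cong {zero}  f≗g = ≡.refl
funToFin-cong {suc m} f≗g = ≡.cong₂ combine (f≗g zero) (funToFin-cong (f≗g ∘ suc))

finToFun-injective : ∀ (S T : Fin (m ℕ.^ n)) → (∀ i → finToFun {m} {n} S i ≡ finToFun T i) → S ≡ T
finToFun-injective {m} {n} S T eq = ≡.trans (≡.sym (Fin.funToFin-finToFin {n} {m} S))
  (≡.trans (funToFin-cong eq) (Fin.funToFin-finToFin {n} {m} T))

module _ (q : ℕ) where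

  horizontal vertical : Vec ℕ 2
  horizontal = q ∷ 0 ∷ []
  vertical   = 0 ∷ q ∷ []

-- If the matrix of lowest coefficients were singular modulo p, then besides
-- the q² coefficients of exponents below q a further independent functional
-- would vanish on ⟨g₀, g₁⟩. Then p^(q²+1) test series are pairwise distinct
-- modulo the ideal, while only p^(q²) combinations of a basis exist.
module Nonsingular {p d} (p-prime : Prime p) (q : ℕ) .{{_ : ℕ.NonZero q}}
  (g : Vector (PowerSeries.Series (rawℤ/p p) 2) 2)
  (support : ∀ i e → ¬ All (q ℕ.∣_) e → g i e ≈ + 0 [mod p ])
  (g-zeros : ∀ i → g i (0 ∷ 0 ∷ []) ≈ + 0 [mod p ])
  (d≤q² : d ≤ q ℕ.* q)
  (quotient : PowerSeries.QuotientHasDimension (rawℤ/p p) g d)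
  where

  open PowerSeries (rawℤ/p p) hiding (degree; _+_; _*_)
  private module P = PowerSeries (rawℤ/p p)
  open CommutativeRing (ℤ/ p) hiding (zero)
  open BoxSums (ℤ/ p)
  open CommutativeMonoidSum +-commutativeMonoid using (sum-cong-≋)
  open SeriesOrder (ℤ/ p) using (mono-≢; mono-refl)
  open QuotientHasDimension quotient using (basis; spanning)
  open import Relation.Binary.Reasoning.Setoid setoid

  private instance
    p≢0 : ℕ.NonZero p
    p≢0 = prime⇒nonZero p-prime

  private
    H V : Vec ℕ 2
    H = horizontal q
    V = vertical q

  -- An exponent with both entries below q is divisible by q only at the origin, where the constant
  -- term vanishes.
  g-small : ∀ i {a b} → a < q → b < q → g i (a ∷ b ∷ []) ≈ + 0
  g-small i {zero}  {zero}  _   _   = g-zeros i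
  g-small i {zero}  {suc b} _   b<q = support i _ λ { (_ ∷ q∣b ∷ []) → ℕ.>⇒∤ b<q q∣b }
  g-small i {suc a} {b}     a<q _   = support i _ λ { (q∣a ∷ _) → ℕ.>⇒∤ a<q q∣a }

  *g-small : ∀ i k {a b} → a < q → b < q → (k P.* g i) (a ∷ b ∷ []) ≈ + 0
  *g-small i k {a} {b} a<q b<q = ∑≤-zero (a ∷ b ∷ []) {λ e → k e * g i ((a ∷ b ∷ []) ∸ᵛ e)} λ where
    (i′ ∷ j′ ∷ []) _ → trans
      (*-congˡ {k (i′ ∷ j′ ∷ [])}
        (g-small i (ℕ.≤-<-trans (ℕ.m∸n≤m a i′) a<q) (ℕ.≤-<-trans (ℕ.m∸n≤m b j′) b<q)))
      (zeroʳ (k (i′ ∷ j′ ∷ [])))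

  private
    0<q : 0 < q
    0<q = ℕ.>-nonZero⁻¹ q

  -- Every splitting of `H` other than 0 + `H` leaves to `g i` an exponent with both entries below
  -- q. So this coefficient sees only the constant term of the multiplier.
  *g-horizontal : ∀ i k → (k P.* g i) H ≈ k (0 ∷ 0 ∷ []) * g i H
  *g-horizontal i k = ∑≤-single H (λ a → k a * g i (H ∸ᵛ a)) {0 ∷ 0 ∷ []} (z≤n ∷ z≤n ∷ []) λ where
    (zero  ∷ zero ∷ []) _ ≢0 → contradiction ≡.refl ≢0
    (suc j ∷ b    ∷ []) (j<q ∷ _) _ → trans
      (*-congˡ {k (suc j ∷ b ∷ [])}
        (g-small i (ℕ.∸-monoʳ-< (s≤s z≤n) j<q) (ℕ.≤-<-trans (ℕ.m∸n≤m 0 b) 0<q)))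
      (zeroʳ (k (suc j ∷ b ∷ [])))
    (_ ∷ suc _ ∷ []) (_ ∷ () ∷ _)

  *g-vertical : ∀ i k → (k P.* g i) V ≈ k (0 ∷ 0 ∷ []) * g i V
  *g-vertical i k = ∑≤-single V (λ a → k a * g i (V ∸ᵛ a)) {0 ∷ 0 ∷ []} (z≤n ∷ z≤n ∷ []) λ where
    (zero ∷ zero  ∷ []) _ ≢0 → contradiction ≡.refl ≢0
    (a    ∷ suc j ∷ []) (_ ∷ j<q ∷ _) _ → trans
      (*-congˡ {k (a ∷ suc j ∷ [])}
        (g-small i (ℕ.≤-<-trans (ℕ.m∸n≤m 0 a) 0<q) (ℕ.∸-monoʳ-< (s≤s z≤n) j<q)))
      (zeroʳ (k (a ∷ suc j ∷ [])))
    (suc _ ∷ _ ∷ []) (() ∷ _)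

  module Functional (u₀ u₁ : ℤ) (annihilates : ∀ i → u₀ * g i H + u₁ * g i V ≈ + 0) where

    ψ : Series 2 → ℤ
    ψ f = u₀ * f H + u₁ * f V

    -- On the ideal, `ψ` is the combination of `ψ (g 0F)` and `ψ (g 1F)` weighted by the constant
    -- terms of the multipliers, and `annihilates` makes both zero.
    ψ-ideal : ∀ {h} → h ∈⟨ g ⟩ → ψ h ≈ + 0
    ψ-ideal {h} (k , h≋) = begin
      u₀ * h H + u₁ * h V
        ≈⟨ +-cong (*-congˡ {u₀} (trans (h≋ H) (sum-cong-≋ {2} λ i → *g-horizontal i (k i))))
                  (*-congˡ {u₁} (trans (h≋ V) (sum-cong-≋ {2} λ i → *g-vertical i (k i)))) ⟩
      u₀ * (c₀ * g 0F H + (c₁ * g 1F H + + 0)) + u₁ * (c₀ * g 0F V + (c₁ * g 1F V + + 0))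
        ≡⟨ regroup u₀ u₁ c₀ c₁ (g 0F H) (g 1F H) (g 0F V) (g 1F V) ⟩
      c₀ * (u₀ * g 0F H + u₁ * g 0F V) + c₁ * (u₀ * g 1F H + u₁ * g 1F V)
        ≈⟨ +-cong (*-congˡ {c₀} (annihilates 0F)) (*-congˡ {c₁} (annihilates 1F)) ⟩
      c₀ * + 0 + c₁ * + 0
        ≈⟨ +-cong (zeroʳ c₀) (zeroʳ c₁) ⟩
      + 0 ∎
      where
      c₀ c₁ : ℤ
      c₀ = k 0F (0 ∷ 0 ∷ [])
      c₁ = k 1F (0 ∷ 0 ∷ [])
      regroup : ∀ u₀ u₁ c₀ c₁ a b c d →
                u₀ ℤ.* (c₀ ℤ.* a ℤ.+ (c₁ ℤ.* b ℤ.+ + 0)) ℤ.+ u₁ ℤ.* (c₀ ℤ.* c ℤ.+ (c₁ ℤ.* d ℤ.+ + 0)) ≡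
                c₀ ℤ.* (u₀ ℤ.* a ℤ.+ u₁ ℤ.* c) ℤ.+ c₁ ℤ.* (u₀ ℤ.* b ℤ.+ u₁ ℤ.* d)
      regroup = ℤSolver.solve-∀

    ideal-small : ∀ {h} → h ∈⟨ g ⟩ → ∀ {a b} → a < q → b < q → h (a ∷ b ∷ []) ≈ + 0
    ideal-small (k , h≋) a<q b<q = trans (h≋ _)
      (trans (sum-cong-≋ {2} λ i → *g-small i (k i) a<q b<q) (≡⇒≈mod ≡.refl))

    module _ (y₀ y₁ : ℤ) (p∤u·y : ¬ + p ℤ.∣ u₀ ℤ.* y₀ ℤ.+ u₁ ℤ.* y₁) where

      digit : Fin p → ℤ
      digit s = + toℕ s

      box : (Fin (suc (q ℕ.* q)) → Fin p) → Series 2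
      box t (a ∷ b ∷ []) with a ℕ.<? q | b ℕ.<? q
      ... | yes a<q | yes b<q = digit (t (suc (combine (fromℕ< a<q) (fromℕ< b<q))))
      ... | _       | _       = + 0

      box-small : ∀ t i j → box t (toℕ i ∷ toℕ j ∷ []) ≡ digit (t (suc (combine i j)))
      box-small t i j with toℕ i ℕ.<? q | toℕ j ℕ.<? q
      ... | yes i<q | yes j<q = ≡.cong₂ (λ i j → digit (t (suc (combine i j))))
                                  (Fin.fromℕ<-toℕ i i<q) (Fin.fromℕ<-toℕ j j<q)
      ... | yes _   | no  j≮q = contradiction (Fin.toℕ<n j) j≮q
      ... | no  i≮q | _       = contradiction (Fin.toℕ<n i) i≮q

      box-H : ∀ t → box t H ≡ + 0
      box-H t with q ℕ.<? q | 0 ℕ.<? q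
      ... | yes q<q | _ = contradiction q<q (ℕ.<-irrefl ≡.refl)
      ... | no  _   | _ = ≡.refl

      box-V : ∀ t → box t V ≡ + 0
      box-V t with 0 ℕ.<? q | q ℕ.<? q
      ... | _     | yes q<q = contradiction q<q (ℕ.<-irrefl ≡.refl)
      ... | yes _ | no  _   = ≡.refl
      ... | no  _ | no  _   = ≡.refl

      -- Of the q² + 1 digits of `t`, the first scales y₀ Z₁^q + y₁ Z₂^q, where `ψ` is a unit modulo
      -- p, and the others are the coefficients with both exponents below q. All of them can be
      -- recovered from the class modulo the ideal.
      test : (Fin (suc (q ℕ.* q)) → Fin p) → Series 2
      test t e = box t e + digit (t zero) * (y₀ * mono H e + y₁ * mono V e)

      H≢V : H ≢ V
      H≢V H≡V = ℕ.<⇒≢ 0<q (≡.sym (≡.cong (λ { (a ∷ _) → a }) H≡V))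

      combine-mono : ∀ {x y} c {r s} → x ≈ r → y ≈ s →
                     c * (y₀ * x + y₁ * y) ≈ c * (y₀ * r + y₁ * s)
      combine-mono c x≈r y≈s = *-congˡ {c} (+-cong (*-congˡ {y₀} x≈r) (*-congˡ {y₁} y≈s))

      test-small : ∀ t i j → test t (toℕ i ∷ toℕ j ∷ []) ≈ digit (t (suc (combine i j)))
      test-small t i j = trans
        (+-cong (≡⇒≈mod (box-small t i j))
          (combine-mono (digit (t zero)) (mono-≢ e≢H) (mono-≢ e≢V)))
        (≡⇒≈mod (simplify _ (digit (t zero)) y₀ y₁))
        where
        e≢H : toℕ i ∷ toℕ j ∷ [] ≢ H
        e≢H e≡H = ℕ.<⇒≢ (Fin.toℕ<n i) (≡.cong (λ { (a ∷ _) → a }) e≡H)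
        e≢V : toℕ i ∷ toℕ j ∷ [] ≢ V
        e≢V e≡V = ℕ.<⇒≢ (Fin.toℕ<n j) (≡.cong (λ { (_ ∷ b ∷ []) → b }) e≡V)
        simplify : ∀ x c y z → x ℤ.+ c ℤ.* (y ℤ.* + 0 ℤ.+ z ℤ.* + 0) ≡ x
        simplify = ℤSolver.solve-∀

      ψ-test : ∀ t → ψ (test t) ≈ (u₀ * y₀ + u₁ * y₁) * digit (t zero)
      ψ-test t = trans
        (+-cong
          (*-congˡ {u₀} (+-cong (≡⇒≈mod (box-H t))
            (combine-mono (digit (t zero)) (mono-refl H) (mono-≢ H≢V))))
          (*-congˡ {u₁} (+-cong (≡⇒≈mod (box-V t))
            (combine-mono (digit (t zero)) (mono-≢ (H≢V ∘ ≡.sym)) (mono-refl V)))))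
        (≡⇒≈mod (simplify u₀ u₁ y₀ y₁ (digit (t zero))))
        where
        simplify : ∀ u₀ u₁ y₀ y₁ c →
          u₀ ℤ.* (+ 0 ℤ.+ c ℤ.* (y₀ ℤ.* + 1 ℤ.+ y₁ ℤ.* + 0)) ℤ.+
          u₁ ℤ.* (+ 0 ℤ.+ c ℤ.* (y₀ ℤ.* + 0 ℤ.+ y₁ ℤ.* + 1)) ≡
          (u₀ ℤ.* y₀ ℤ.+ u₁ ℤ.* y₁) ℤ.* c
        simplify = ℤSolver.solve-∀

      combination-cong : ∀ {d} {r s : Vector ℤ d} (b : Vector (Series 2) d) →
                         (∀ j → r j ≈ s j) → combination r b ≋ combination s b
      combination-cong {zero}  b r≈s e = refl
      combination-cong {suc d} b r≈s e =
        +-cong (*-congʳ {b zero e} (r≈s zero)) (combination-cong (b ∘ suc) (r≈s ∘ suc) e)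

      module _ (s t : Fin (suc (q ℕ.* q)) → Fin p)
        (coordinates≈ : ∀ j → proj₁ (spanning (test s)) j ≈ proj₁ (spanning (test t)) j)
        where

        private
          C : (Fin (suc (q ℕ.* q)) → Fin p) → Series 2
          C t = combination (proj₁ (spanning (test t))) basis

          Cs≋Ct : C s ≋ C t
          Cs≋Ct = combination-cong basis coordinates≈

          small : ∀ t i j → digit (t (suc (combine i j))) ≈ C t (toℕ i ∷ toℕ j ∷ [])
          small t i j with spanning (test t)
          ... | r , h , h∈ , f≋ = trans (sym (test-small t i j)) (trans (f≋ _)
            (trans (+-congˡ {combination r basis (toℕ i ∷ toℕ j ∷ [])}
                     (ideal-small h∈ (Fin.toℕ<n i) (Fin.toℕ<n j)))
                   (+-identityʳ _)))

          corner : ∀ t → (u₀ * y₀ + u₁ * y₁) * digit (t zero) ≈ ψ (C t)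
          corner t with spanning (test t)
          ... | r , h , h∈ , f≋ = begin
            (u₀ * y₀ + u₁ * y₁) * digit (t zero) ≈⟨ ψ-test t ⟨
            ψ (test t)                           ≈⟨ +-cong (*-congˡ {u₀} (f≋ H)) (*-congˡ {u₁} (f≋ V)) ⟩
            u₀ * (c H + h H) + u₁ * (c V + h V)
              ≡⟨ regroup u₀ u₁ (c H) (c V) (h H) (h V) ⟩
            ψ c + ψ h                            ≈⟨ +-congˡ {ψ c} (ψ-ideal h∈) ⟩
            ψ c + + 0                            ≈⟨ +-identityʳ (ψ c) ⟩
            ψ c ∎
            where
            c : Series 2
            c = combination r basis
            regroup : ∀ u₀ u₁ a b c d → u₀ ℤ.* (a ℤ.+ c) ℤ.+ u₁ ℤ.* (b ℤ.+ d) ≡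
                      (u₀ ℤ.* a ℤ.+ u₁ ℤ.* b) ℤ.+ (u₀ ℤ.* c ℤ.+ u₁ ℤ.* d)
            regroup = ℤSolver.solve-∀

        -- The coefficients below q and the functional `ψ` do not see the ideal, so they depend only
        -- on the coordinates. The first digit is then recovered by cancelling u₀ y₀ + u₁ y₁, which
        -- is prime to p.
        coordinates-injective : ∀ k → s k ≡ t k
        coordinates-injective zero = toℕ-injective-mod (s zero) (t zero)
          (mod (Sum.fromInj₂ (λ p∣uy → contradiction p∣uy p∤u·y)
            (prime-∣-* p-prime (≡.subst (+ p ℤ.∣_)
              (factor (u₀ * y₀ + u₁ * y₁) (digit (s zero)) (digit (t zero))) (difference corners≈)))))
          where
          corners≈ : (u₀ * y₀ + u₁ * y₁) * digit (s zero) ≈ (u₀ * y₀ + u₁ * y₁) * digit (t zero)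
          corners≈ = trans (corner s) (trans
            (+-cong (*-congˡ {u₀} (Cs≋Ct H)) (*-congˡ {u₁} (Cs≋Ct V))) (sym (corner t)))
          factor : ∀ c x y → c ℤ.* x ℤ.- c ℤ.* y ≡ c ℤ.* (x ℤ.- y)
          factor = ℤSolver.solve-∀
        coordinates-injective (suc k) with Fin.combine-surjective {q} {q} k
        ... | i , j , ≡.refl = toℕ-injective-mod (s (suc k)) (t (suc k))
          (trans (small s i j) (trans (Cs≋Ct _) (sym (small t i j))))

      coordinates : Fin (p ℕ.^ suc (q ℕ.* q)) → Fin (p ℕ.^ d)
      coordinates T = funToFin (λ j → residue (proj₁ (spanning (test (finToFun T))) j))

      absurd : ∀ {a} {A : Set a} → A
      absurd with Fin.pigeonhole
        (ℕ.^-monoʳ-< p (ℕ.nonTrivial⇒n>1 p {{prime⇒nonTrivial p-prime}}) (s≤s d≤q²)) coordinates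
      ... | S , T , S<T , eq = contradiction (finToFun-injective {p} {suc (q ℕ.* q)} S T
            (coordinates-injective (finToFun S) (finToFun T) λ j → residue-injective _ _
              (≡.trans (≡.sym (Fin.finToFun-funToFin _ j))
                (≡.trans (≡.cong (λ F → finToFun {p} {d} F j) eq) (Fin.finToFun-funToFin _ j)))))
            (Fin.<⇒≢ S<T)

  -- A row that is non-zero modulo p yields a non-zero vector u orthogonal to both rows, namely (-b,
  -- a) or (-e, c); if all entries vanish, (1, 0) serves. The vector y is a signed unit vector that
  -- picks out an entry of u prime to p.
  nonsingular : ¬ + p ℤ.∣ g 0F H ℤ.* g 1F V ℤ.- g 0F V ℤ.* g 1F H
  nonsingular p∣det = cases (+ p ℤ.∣? a) (+ p ℤ.∣? b) (+ p ℤ.∣? c) (+ p ℤ.∣? e)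
    where
    a b c e : ℤ
    a = g 0F H
    b = g 0F V
    c = g 1F H
    e = g 1F V
    row : ∀ x y → (ℤ.- y) ℤ.* x ℤ.+ x ℤ.* y ≡ + 0
    row = ℤSolver.solve-∀
    det : ∀ a b c e → (ℤ.- b) ℤ.* c ℤ.+ a ℤ.* e ≡ a ℤ.* e ℤ.- b ℤ.* c
    det = ℤSolver.solve-∀
    pick₁ : ∀ x y → x ≡ (ℤ.- y) ℤ.* + 0 ℤ.+ x ℤ.* + 1
    pick₁ = ℤSolver.solve-∀
    pick₀ : ∀ x y → y ≡ (ℤ.- y) ℤ.* (ℤ.- + 1) ℤ.+ x ℤ.* + 0
    pick₀ = ℤSolver.solve-∀
    row₀ : ∀ i → (ℤ.- b) * g i H + a * g i V ≈ + 0
    row₀ 0F = ≡⇒≈mod (row a b)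
    row₀ 1F = trans (≡⇒≈mod (det a b c e)) (∣⇒≈0 p∣det)
    zero-row : ∀ {x y} u v → + p ℤ.∣ x → + p ℤ.∣ y → u * x + v * y ≈ + 0
    zero-row u v p∣x p∣y = ∣⇒≈0 (ℤ.∣m∣n⇒∣m+n (ℤ.∣n⇒∣m*n u p∣x) (ℤ.∣n⇒∣m*n v p∣y))
    row₁ : + p ℤ.∣ a → + p ℤ.∣ b → ∀ i → (ℤ.- e) * g i H + c * g i V ≈ + 0
    row₁ p∣a p∣b 0F = zero-row (ℤ.- e) c p∣a p∣b
    row₁ p∣a p∣b 1F = ≡⇒≈mod (row c e)
    cases : Dec (+ p ℤ.∣ a) → Dec (+ p ℤ.∣ b) → Dec (+ p ℤ.∣ c) → Dec (+ p ℤ.∣ e) → ⊥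
    cases (no p∤a) _ _ _ = Functional.absurd (ℤ.- b) a row₀ (+ 0) (+ 1)
      (p∤a ∘ ≡.subst (+ p ℤ.∣_) (≡.sym (pick₁ a b)))
    cases _ (no p∤b) _ _ = Functional.absurd (ℤ.- b) a row₀ (ℤ.- + 1) (+ 0)
      (p∤b ∘ ≡.subst (+ p ℤ.∣_) (≡.sym (pick₀ a b)))
    cases (yes p∣a) (yes p∣b) (no p∤c) _ = Functional.absurd (ℤ.- e) c (row₁ p∣a p∣b) (+ 0) (+ 1)
      (p∤c ∘ ≡.subst (+ p ℤ.∣_) (≡.sym (pick₁ c e)))
    cases (yes p∣a) (yes p∣b) _ (no p∤e) = Functional.absurd (ℤ.- e) c (row₁ p∣a p∣b) (ℤ.- + 1) (+ 0)
      (p∤e ∘ ≡.subst (+ p ℤ.∣_) (≡.sym (pick₀ c e)))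
    cases (yes p∣a) (yes p∣b) (yes p∣c) (yes p∣e) = Functional.absurd (+ 1) (+ 0)
      (λ { 0F → zero-row (+ 1) (+ 0) p∣a p∣b ; 1F → zero-row (+ 1) (+ 0) p∣c p∣e })
      (+ 1) (+ 0) (λ p∣1 → ℕ.>⇒∤ (ℕ.nonTrivial⇒n>1 p {{prime⇒nonTrivial p-prime}}) (ℤ.∣⇒∣ᵤ p∣1))

-- Valuations

infixr 8 _×ℚ_

_×ℚ_ : ℕ → ℚ → ℚ
_×ℚ_ = Algebra.Definitions.RawMonoid._×_ ℚ.+-0-rawMonoid

×ℚ-homo-+ : ∀ x m n → (m ℕ.+ n) ×ℚ x ≡ m ×ℚ x ℚ.+ n ×ℚ x
×ℚ-homo-+ = MonoidMult.×-homo-+ ℚ.+-0-monoid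

×ℚ-nonNegative : ∀ n {x} → 0ℚ ℚ.≤ x → 0ℚ ℚ.≤ n ×ℚ x
×ℚ-nonNegative zero    0≤x = ℚ.≤-refl
×ℚ-nonNegative (suc n) 0≤x = ℚ.+-mono-≤ 0≤x (×ℚ-nonNegative n 0≤x)

×ℚ-monoˡ-≤ : ∀ {m n x} → 0ℚ ℚ.≤ x → m ≤ n → m ×ℚ x ℚ.≤ n ×ℚ x
×ℚ-monoˡ-≤ {n = n} 0≤x z≤n       = ×ℚ-nonNegative n 0≤x
×ℚ-monoˡ-≤ {x = x} 0≤x (s≤s m≤n) = ℚ.+-monoʳ-≤ x (×ℚ-monoˡ-≤ 0≤x m≤n)

<-+ʳ : ∀ {x y} → 0ℚ ℚ.< y → x ℚ.< x ℚ.+ y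
<-+ʳ {x} {y} 0<y = ≡.subst (ℚ._< x ℚ.+ y) (ℚ.+-identityʳ x) (ℚ.+-monoʳ-< x 0<y)

×ℚ-monoˡ-< : ∀ {m n x} → 0ℚ ℚ.< x → m < n → m ×ℚ x ℚ.< n ×ℚ x
×ℚ-monoˡ-< {m} {n} {x} 0<x m<n = ℚ.<-≤-trans
  (≡.subst (m ×ℚ x ℚ.<_) (ℚ.+-comm (m ×ℚ x) x) (<-+ʳ 0<x))
  (×ℚ-monoˡ-≤ {suc m} {n} (ℚ.<⇒≤ 0<x) m<n)

0<1 : 0ℚ ℚ.< 1ℚ
0<1 = *<* (ℤ.+<+ (s≤s z≤n))

fromℕ : ℕ → ℚ
fromℕ n = mkℚ (+ n) 0 (Coprimality.sym (Coprimality.1-coprimeTo n))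

fromℕ≡/1 : ∀ n → + n ℚ./ 1 ≡ fromℕ n
fromℕ≡/1 n = ℚ.↥p/↧p≡p (fromℕ n)

1+fromℕ : ∀ n → 1ℚ ℚ.+ fromℕ n ≡ fromℕ (suc n)
1+fromℕ n = ≡.trans (≡.cong (λ z → (+ 1 ℤ.+ z) ℚ./ 1) (ℤ.*-identityʳ (+ n))) (fromℕ≡/1 (suc n))

×ℚ-fromℕ : ∀ n x → n ×ℚ x ≡ fromℕ n ℚ.* x
×ℚ-fromℕ zero    x = ≡.sym (ℚ.*-zeroˡ x)
×ℚ-fromℕ (suc n) x = begin
  x ℚ.+ n ×ℚ x                 ≡⟨ ≡.cong₂ ℚ._+_ (≡.sym (ℚ.*-identityˡ x)) (×ℚ-fromℕ n x) ⟩
  1ℚ ℚ.* x ℚ.+ fromℕ n ℚ.* x   ≡⟨ ℚ.*-distribʳ-+ x 1ℚ (fromℕ n) ⟨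
  (1ℚ ℚ.+ fromℕ n) ℚ.* x       ≡⟨ ≡.cong (ℚ._* x) (1+fromℕ n) ⟩
  fromℕ (suc n) ℚ.* x          ∎
  where open ≡.≡-Reasoning

archimedean : ∀ x → ∃ λ n → x ℚ.< fromℕ n
archimedean (mkℚ (+ n) d _) = suc n , *<* (≡.subst₂ ℤ._<_
  (≡.sym (ℤ.*-identityʳ (+ n))) (ℤ.pos-* (suc n) (suc d))
  (ℤ.+<+ (ℕ.m≤m*n (suc n) (suc d))))
archimedean (mkℚ -[1+ n ] d _) = 0 , *<* ℤ.-<+

archimedean-× : ∀ x {y} → 0ℚ ℚ.< y → ∃ λ N → x ℚ.< N ×ℚ y
archimedean-× x {y} 0<y = N , ≡.subst₂ ℚ._<_ cancel (≡.sym (×ℚ-fromℕ N y))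
  (ℚ.*-monoˡ-<-pos y (proj₂ (archimedean (x ℚ.* ℚ.1/ y))))
  where
  instance
    y-pos : ℚ.Positive y
    y-pos = ℚ.positive 0<y
    y≢0 : ℚ.NonZero y
    y≢0 = ℚ.pos⇒nonZero y
  N : ℕ
  N = proj₁ (archimedean (x ℚ.* ℚ.1/ y))
  cancel : x ℚ.* ℚ.1/ y ℚ.* y ≡ x
  cancel = ≡.trans (ℚ.*-assoc x (ℚ.1/ y) y)
    (≡.trans (≡.cong (x ℚ.*_) (ℚ.*-inverseˡ y)) (ℚ.*-identityʳ x))

×ℚ≡1⇒≡1/ : ∀ n .{{_ : ℕ.NonZero n}} {x} → n ×ℚ x ≡ 1ℚ → x ≡ + 1 ℚ./ n
×ℚ≡1⇒≡1/ n@(suc k) {x} nx≡1 = begin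
  x                                ≡⟨ ℚ.*-identityˡ x ⟨
  1ℚ ℚ.* x                         ≡⟨ ≡.cong (ℚ._* x) inverse ⟨
  (+ 1 ℚ./ n) ℚ.* fromℕ n ℚ.* x    ≡⟨ ℚ.*-assoc (+ 1 ℚ./ n) (fromℕ n) x ⟩
  (+ 1 ℚ./ n) ℚ.* (fromℕ n ℚ.* x)  ≡⟨ ≡.cong ((+ 1 ℚ./ n) ℚ.*_) (≡.trans (≡.sym (×ℚ-fromℕ n x)) nx≡1) ⟩
  (+ 1 ℚ./ n) ℚ.* 1ℚ               ≡⟨ ℚ.*-identityʳ (+ 1 ℚ./ n) ⟩
  + 1 ℚ./ n                        ∎
  where
  open ≡.≡-Reasoning
  inverse : (+ 1 ℚ./ n) ℚ.* fromℕ n ≡ 1ℚ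
  inverse = ℚ.toℚᵘ-injective (ℚᵘ.≃-trans (ℚ.toℚᵘ-homo-* (+ 1 ℚ./ n) (fromℕ n))
    (ℚᵘ.≃-trans (ℚᵘ.*-congʳ (ℚ.toℚᵘ-fromℚᵘ (ℚᵘ.mkℚᵘ (+ 1) k)))
      (ℚᵘ.*≡* (≡.trans (ℤ.*-identityʳ (+ 1 ℤ.* + n))
        (≡.cong (λ z → + 1 ℤ.* + z) (≡.sym (ℕ.*-identityʳ n)))))))

+⁺-mono-≤⁺ : ∀ {a b x y} → [ a ] ≤⁺ x → [ b ] ≤⁺ y → [ a ℚ.+ b ] ≤⁺ x +⁺ y
+⁺-mono-≤⁺ [ p ]      [ q ]      = [ ℚ.+-mono-≤ p q ]
+⁺-mono-≤⁺ [ p ]      (_ ≤⊤⁺)    = _ ≤⊤⁺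
+⁺-mono-≤⁺ (_ ≤⊤⁺)    _          = _ ≤⊤⁺

<⁺⇒≤⁺ : ∀ {a x} → [ a ] <⁺ x → [ a ] ≤⁺ x
<⁺⇒≤⁺ [ p ]      = [ ℚ.<⇒≤ p ]
<⁺⇒≤⁺ [ _ ]<⊤⁺   = _ ≤⊤⁺

≤⁺-⊓⁺ : ∀ {a x y} → [ a ] ≤⁺ x → [ a ] ≤⁺ y → [ a ] ≤⁺ x ⊓⁺ y
≤⁺-⊓⁺ [ p ]   [ q ]   = [ ℚ.⊓-glb p q ]
≤⁺-⊓⁺ [ p ]   (_ ≤⊤⁺) = [ p ]
≤⁺-⊓⁺ (_ ≤⊤⁺) q       = q

<⁺-⊓⁺ : ∀ {a x y} → [ a ] <⁺ x → [ a ] <⁺ y → [ a ] <⁺ x ⊓⁺ y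
<⁺-⊓⁺ {x = [ x ]} {[ y ]} [ p ] [ q ] with ℚ.⊓-sel x y
... | inj₁ eq = [ ≡.subst (_ ℚ.<_) (≡.sym eq) p ]
... | inj₂ eq = [ ≡.subst (_ ℚ.<_) (≡.sym eq) q ]
<⁺-⊓⁺ [ p ]    [ _ ]<⊤⁺ = [ p ]
<⁺-⊓⁺ [ _ ]<⊤⁺ q        = q

<⁺-≤⁺-trans : ∀ {a b x} → a ℚ.< b → [ b ] ≤⁺ x → [ a ] <⁺ x
<⁺-≤⁺-trans a<b b≤x = <⁺-transˡ ℚ.<-≤-trans [ a<b ] b≤x

<⁺-irrefl : ∀ {a x} → x ≡ [ a ] → ¬ [ a ] <⁺ x
<⁺-irrefl ≡.refl [ a<a ] = ℚ.<-irrefl ≡.refl a<a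

module Valuation {p c ℓ₁ ℓ₂} (K : ValuedAlgebraicClosure p c ℓ₁ ℓ₂) where

  open ValuedAlgebraicClosure K
    using (ι; ι-isHomomorphism; v; v-cong; v-∞; v-*; v-+; v-ℤₚ)
    renaming (commutativeRing to 𝐊)
  open CommutativeRing 𝐊 hiding (zero)
  open Monomials (Semiring.rawSemiring semiring)
  open RingMorphisms.IsRingHomomorphism ι-isHomomorphism
  open RingProperties ring using (-1*x≈-x; x[y-z]≈xy-xz; [y-z]x≈yx-zx)
  open AbelianGroupProperties +-abelianGroup using (⁻¹-∙-comm; ⁻¹-anti-homo‿-; ε⁻¹≈ε)
  open CommutativeSemigroupProperties +-commutativeSemigroup using (interchange)
  private module ℤₚ = CommutativeRing (ℤₚ p)

  v-0 : v 0# ≡ ⊤⁺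
  v-0 = Equivalence.from (v-∞ 0#) refl

  v-≥-+ : ∀ {a x y} → [ a ] ≤⁺ v x → [ a ] ≤⁺ v y → [ a ] ≤⁺ v (x + y)
  v-≥-+ {x = x} {y} a≤x a≤y = ≤⁺-trans ℚ.≤-trans (≤⁺-⊓⁺ a≤x a≤y) (v-+ x y)

  v->-+ : ∀ {a x y} → [ a ] <⁺ v x → [ a ] <⁺ v y → [ a ] <⁺ v (x + y)
  v->-+ {x = x} {y} a<x a<y = <⁺-transˡ ℚ.<-≤-trans (<⁺-⊓⁺ a<x a<y) (v-+ x y)

  v-≥-* : ∀ {a b x y} → [ a ] ≤⁺ v x → [ b ] ≤⁺ v y → [ a ℚ.+ b ] ≤⁺ v (x * y)
  v-≥-* {x = x} {y} a≤x b≤y = ≡.subst (_ ≤⁺_) (≡.sym (v-* x y)) (+⁺-mono-≤⁺ a≤x b≤y)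

  v->-*ˡ : ∀ {a x y} → [ 0ℚ ] ≤⁺ v x → [ a ] <⁺ v y → [ a ] <⁺ v (x * y)
  v->-*ˡ {a} {x} {y} 0≤x a<y = ≡.subst ([ a ] <⁺_) (≡.sym (v-* x y)) (add 0≤x a<y)
    where
    add : ∀ {r s} → [ 0ℚ ] ≤⁺ r → [ a ] <⁺ s → [ a ] <⁺ r +⁺ s
    add [ 0≤r ]   [ a<s ]  = [ ≡.subst (ℚ._< _) (ℚ.+-identityˡ a) (ℚ.+-mono-≤-< 0≤r a<s) ]
    add [ 0≤r ]   [ _ ]<⊤⁺ = [ a ]<⊤⁺
    add (_ ≤⊤⁺)   _        = [ a ]<⊤⁺

  v->-*ʳ : ∀ {a x y} → [ a ] <⁺ v x → [ 0ℚ ] ≤⁺ v y → [ a ] <⁺ v (x * y)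
  v->-*ʳ {x = x} {y} a<x 0≤y =
    ≡.subst (_ <⁺_) (v-cong (*-comm y x)) (v->-*ˡ 0≤y a<x)

  Integral : Carrier → Set
  Integral x = [ 0ℚ ] ≤⁺ v x

  integral-0 : Integral 0#
  integral-0 = ≡.subst (_ ≤⁺_) (≡.sym v-0) (_ ≤⊤⁺)

  integral-1 : Integral 1#
  integral-1 = ≡.subst (_ ≤⁺_) (v-cong 1#-homo) (v-ℤₚ ℤₚ.1#)

  integral-* : ∀ {x y} → Integral x → Integral y → Integral (x * y)
  integral-* ix iy = v-≥-* ix iy

  -- Writes negation as multiplication by an element of ℤ_p, so that `v-ℤₚ` and `v-*` bound the
  -- valuation of a negative.
  ι-1*x≈-x : ∀ x → ι (ℤₚ.- ℤₚ.1#) * x ≈ - x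
  ι-1*x≈-x x = trans (*-congʳ (trans (-‿homo ℤₚ.1#) (-‿cong 1#-homo))) (-1*x≈-x x)

  integral-neg : ∀ {x} → Integral x → Integral (- x)
  integral-neg {x} ix = ≡.subst (_ ≤⁺_) (v-cong (ι-1*x≈-x x)) (integral-* (v-ℤₚ _) ix)

  v->-neg : ∀ {a x} → [ a ] <⁺ v x → [ a ] <⁺ v (- x)
  v->-neg {x = x} a<x = ≡.subst (_ <⁺_) (v-cong (ι-1*x≈-x x)) (v->-*ˡ (v-ℤₚ _) a<x)

  v-^-≥ : ∀ {a x} → [ a ] ≤⁺ v x → ∀ n → [ n ×ℚ a ] ≤⁺ v (x ^ n)
  v-^-≥ a≤x zero    = integral-1
  v-^-≥ a≤x (suc n) = v-≥-* a≤x (v-^-≥ a≤x n)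

  v-^^-≥ : ∀ {n a} {x : Vector Carrier n} → (∀ i → [ a ] ≤⁺ v (x i)) →
           ∀ e → [ degree e ×ℚ a ] ≤⁺ v (x ^^ e)
  v-^^-≥ a≤x []       = integral-1
  v-^^-≥ {a = a} a≤x (e ∷ es) = ≡.subst (λ z → [ z ] ≤⁺ _) (≡.sym (×ℚ-homo-+ a e (degree es)))
    (v-≥-* (v-^-≥ (a≤x zero) e) (v-^^-≥ (a≤x ∘ suc) es))

  v-^ : ∀ {a x} → v x ≡ [ a ] → ∀ n → v (x ^ n) ≡ [ n ×ℚ a ]
  -- v(1) = 0 results from v(x · 1) = v(x) by cancelling v(x), which is possible because v(x) = a is
  -- finite.
  v-^ {a} {x} vx≡a zero = v-1 (v 1#) (≡.trans (≡.cong (_+⁺ v 1#) (≡.sym vx≡a))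
    (≡.trans (≡.sym (v-* x 1#)) (≡.trans (v-cong (*-identityʳ x)) vx≡a)))
    where
    v-1 : ∀ r → [ a ] +⁺ r ≡ [ a ] → r ≡ [ 0ℚ ]
    v-1 [ r ] eq with r ℚ.≟ 0ℚ
    ... | yes r≡0 = ≡.cong [_] r≡0
    ... | no r≢0 = contradiction (cancel eq) r≢0
      where
      open GroupProperties ℚ.+-0-group using (∙-cancelˡ)
      cancel : [ a ℚ.+ r ] ≡ [ a ] → r ≡ 0ℚ
      cancel eq = ∙-cancelˡ a r 0ℚ (≡.trans ([]-injective eq) (≡.sym (ℚ.+-identityʳ a)))
    v-1 ⊤⁺    ()
  v-^ {x = x} vx≡a (suc n) = ≡.trans (v-* x (x ^ n)) (≡.cong₂ _+⁺_ vx≡a (v-^ vx≡a n))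

  -- The ring of integers modulo the ideal of all elements of valuation > s.
  module Modulo (s : ℚ) where

    infix 4 _≈ₛ_

    -- The bound is irrelevant, so that conversion never compares proofs about v.
    record 𝒪 : Set c where
      constructor _,_
      field
        value     : Carrier
        .bounded  : Integral value

    open 𝒪 public using (value)

    integral : ∀ x → Integral (value x)
    integral (x , 0≤x) = recompute (≤⁺-dec ℚ._≤?_ [ 0ℚ ] (v x)) 0≤x

    -- Strictness is essential: an element of valuation exactly s stays distinct from zero, and both
    -- slope contradictions rest on such an element.
    record _≈ₛ_ (x y : 𝒪) : Set where
      constructor close
      field distance : [ s ] <⁺ v (value x - value y)

    open _≈ₛ_ public

    ≈⇒≈ₛ : ∀ {x y} → value x ≈ value y → x ≈ₛ y
    ≈⇒≈ₛ {x} {y} x≈y = close (≡.subst ([ s ] <⁺_)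
      (≡.sym (≡.trans (v-cong (trans (+-congʳ x≈y) (-‿inverseʳ (value y)))) v-0)) [ s ]<⊤⁺)

    private
      respects : ∀ {x y} → x ≈ y → [ s ] <⁺ v x → [ s ] <⁺ v y
      respects x≈y = ≡.subst ([ s ] <⁺_) (v-cong x≈y)

      telescope : ∀ x y z → (x - y) + (y - z) ≈ x - z
      telescope x y z = trans (+-assoc x (- y) (y - z)) (+-congˡ
        (trans (sym (+-assoc (- y) y (- z))) (trans (+-congʳ (-‿inverseˡ y)) (+-identityˡ (- z)))))

    quotientRing : CommutativeRing c _
    quotientRing = record
      { Carrier = 𝒪
      ; _≈_ = _≈ₛ_
      ; _+_ = λ x y → value x + value y , v-≥-+ (integral x) (integral y)
      ; _*_ = λ x y → value x * value y , integral-* (integral x) (integral y)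
      ; -_  = λ x → - value x , integral-neg (integral x)
      ; 0#  = 0# , integral-0
      ; 1#  = 1# , integral-1
      ; isCommutativeRing = record
        { isRing = record
          { +-isAbelianGroup = record
            { isGroup = record
              { isMonoid = record
                { isSemigroup = record
                  { isMagma = record
                    { isEquivalence = record
                      { refl = ≈⇒≈ₛ refl
                      ; sym = λ { {x} {y} (close d) →
                          close (respects (⁻¹-anti-homo‿- (value x) (value y)) (v->-neg d)) }
                      ; trans = λ { {x} {y} {z} (close d) (close e) →
                          close (respects (telescope (value x) (value y) (value z)) (v->-+ d e)) } }
                    ; ∙-cong = λ { {x} {y} {u} {w} (close d) (close e) →
                        close (respects (trans (interchange (value x) (- value y) (value u) (- value w))
                          (+-congˡ (⁻¹-∙-comm (value y) (value w)))) (v->-+ d e)) } }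
                  ; assoc = λ x y z → ≈⇒≈ₛ (+-assoc (value x) (value y) (value z)) }
                ; identity = (λ x → ≈⇒≈ₛ (+-identityˡ (value x)))
                           , (λ x → ≈⇒≈ₛ (+-identityʳ (value x))) }
              ; inverse = (λ x → ≈⇒≈ₛ (-‿inverseˡ (value x))) , (λ x → ≈⇒≈ₛ (-‿inverseʳ (value x)))
              ; ⁻¹-cong = λ { {x} {y} (close d) →
                  close (respects (sym (⁻¹-∙-comm (value x) (- value y))) (v->-neg d)) } }
            ; comm = λ x y → ≈⇒≈ₛ (+-comm (value x) (value y)) }
          ; *-cong = λ { {x} {y} {u} {w} (close d) (close e) → close (respects
              (trans (+-cong (x[y-z]≈xy-xz (value x) (value u) (value w))
                             ([y-z]x≈yx-zx (value w) (value x) (value y)))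
                (telescope (value x * value u) (value x * value w) (value y * value w)))
              (v->-+ (v->-*ˡ (integral x) e) (v->-*ʳ d (integral w)))) }
          ; *-assoc = λ x y z → ≈⇒≈ₛ (*-assoc (value x) (value y) (value z))
          ; *-identity = (λ x → ≈⇒≈ₛ (*-identityˡ (value x))) , (λ x → ≈⇒≈ₛ (*-identityʳ (value x)))
          ; distrib = (λ x y z → ≈⇒≈ₛ (distribˡ (value x) (value y) (value z)))
                    , (λ x y z → ≈⇒≈ₛ (distribʳ (value x) (value y) (value z))) }
        ; *-comm = λ x y → ≈⇒≈ₛ (*-comm (value x) (value y)) } }

    private module Q = CommutativeRing quotientRing

    x-0≈x : ∀ x → x - 0# ≈ x
    x-0≈x x = trans (+-congˡ ε⁻¹≈ε) (+-identityʳ x)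

    small⇒≈0 : ∀ {x} → [ s ] <⁺ v (value x) → x ≈ₛ Q.0#
    small⇒≈0 {x} s<x = close (respects (sym (x-0≈x (value x))) s<x)

    ≈0⇒small : ∀ {x} → x ≈ₛ Q.0# → [ s ] <⁺ v (value x)
    ≈0⇒small {x} (close d) = respects (x-0≈x (value x)) d

    ιₛ : PAdic p → 𝒪
    ιₛ a = ι a , v-ℤₚ a

    ιₛ-isHomomorphism : SemiringMorphisms.IsSemiringHomomorphism (rawℤₚ p)
      (Semiring.rawSemiring Q.semiring) ιₛ
    ιₛ-isHomomorphism = record
      { isNearSemiringHomomorphism = record
        { +-isMonoidHomomorphism = record
          { isMagmaHomomorphism = record
            { isRelHomomorphism = record { cong = λ a≈b → ≈⇒≈ₛ (⟦⟧-cong a≈b) }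
            ; homo = λ a b → ≈⇒≈ₛ (+-homo a b) }
          ; ε-homo = ≈⇒≈ₛ 0#-homo }
        ; *-homo = λ a b → ≈⇒≈ₛ (*-homo a b) }
      ; 1#-homo = ≈⇒≈ₛ 1#-homo }

    private module MQ = Monomials (Semiring.rawSemiring Q.semiring)

    value-sum : ∀ {n} (t : Vector 𝒪 n) → value (MQ.sum t) ≡ sum (value ∘ t)
    value-sum {zero}  t = ≡.refl
    value-sum {suc n} t = ≡.cong (λ z → value (t zero) + z) (value-sum (t ∘ suc))

    private
      sum-cong : ∀ n {s t : Vector Carrier n} → (∀ i → s i ≡ t i) → sum s ≡ sum t
      sum-cong zero    s≗t = ≡.refl
      sum-cong (suc n) s≗t = ≡.cong₂ _+_ (s≗t zero) (sum-cong n (s≗t ∘ suc))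

      ∑≤-cong : ∀ {n} (b : Vec ℕ n) {f g : Vec ℕ n → Carrier} →
                (∀ a → f a ≡ g a) → ∑≤ b f ≡ ∑≤ b g
      ∑≤-cong []       f≗g = f≗g []
      ∑≤-cong (b ∷ bs) f≗g = sum-cong (suc b) λ i → ∑≤-cong bs (f≗g ∘ (toℕ i ∷_))

    value-∑≤ : ∀ {n} (b : Vec ℕ n) (f : Vec ℕ n → 𝒪) → value (MQ.∑≤ b f) ≡ ∑≤ b (value ∘ f)
    value-∑≤ []       f = ≡.refl
    value-∑≤ (b ∷ bs) f = ≡.trans (value-sum {suc b} λ i → MQ.∑≤ bs (f ∘ (toℕ i ∷_)))
      (sum-cong (suc b) λ i → value-∑≤ bs (f ∘ (toℕ i ∷_)))

    value-^ : ∀ (x : 𝒪) n → value (x MQ.^ n) ≡ value x ^ n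
    value-^ x zero    = ≡.refl
    value-^ x (suc n) = ≡.cong (value x *_) (value-^ x n)

    value-^^ : ∀ {n} (x : Vector 𝒪 n) a → value (x MQ.^^ a) ≡ (value ∘ x) ^^ a
    value-^^ x []       = ≡.refl
    value-^^ x (a ∷ as) = ≡.cong₂ _*_ (value-^ (x zero) a) (value-^^ (x ∘ suc) as)

    open Evaluation (ℤₚ p) quotientRing ιₛ ιₛ-isHomomorphism

    value-eval : ∀ {n} N (x : Vector 𝒪 n) f →
                 value (eval N x f) ≡ ValuedAlgebraicClosure.partialSum K f (value ∘ x) N
    value-eval {n} N x f = ≡.trans (value-∑≤ (replicate n N) _)
      (∑≤-cong (replicate n N) λ a → ≡.cong (ι (f a) *_) (value-^^ x a))

    -- For an integer M > s, partial sums within valuation M of the limit are equal to it modulo s,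
    -- so convergence turns into eventual equality.
    eval-limit : ∀ {n} (x : Vector 𝒪 n) f z → ValuedAlgebraicClosure._⟨_⟩⟶_ K f (value ∘ x) (value z) →
                 ∃ λ N₀ → ∀ N → N₀ ≤ N → eval N x f ≈ₛ z
    eval-limit x f z converges with archimedean s
    ... | M , s<M with converges M
    ... | N₀ , close-to = N₀ , λ N N₀≤N → close (<⁺-≤⁺-trans s<M
      (≡.subst₂ (λ r y → [ r ] ≤⁺ v (y - value z)) (fromℕ≡/1 M) (≡.sym (value-eval N x f))
        (close-to N N₀≤N)))

    -- A monomial of degree at least D has valuation at least Dμ, and the Archimedean property
    -- supplies D with Dμ > s.
    nilpotent : ∀ {n μ} → 0ℚ ℚ.< μ → (x : Vector 𝒪 n) → (∀ i → [ μ ] ≤⁺ v (value (x i))) →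
                ∃ λ D → Nilpotent D x
    nilpotent {μ = μ} 0<μ x μ≤x with archimedean-× s 0<μ
    ... | D , s<Dμ = D , λ a D≤deg → small⇒≈0 (≡.subst (λ y → [ s ] <⁺ v y)
      (≡.sym (value-^^ x a))
      (<⁺-≤⁺-trans (ℚ.<-≤-trans s<Dμ (×ℚ-monoˡ-≤ (ℚ.<⇒≤ 0<μ) D≤deg)) (v-^^-≥ μ≤x a)))

    module _ {n} (𝐅 : PowerSeries.FormalGroupLaw (rawℤₚ p) n) where

      open PowerSeries.FormalGroupLaw 𝐅
      open MultEvaluation (ℤₚ p) quotientRing ιₛ ιₛ-isHomomorphism 𝐅
      open ValuedAlgebraicClosure K using (Multiple; one; add; In𝔪̄)

      -- Every intermediate multiple lies in 𝔪̄, so it is integral and has a class modulo s. The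
      -- integrality proofs are returned too, because the next summation step has to form these
      -- classes.
      multiple⇒iteratedSum : (x : Vector 𝒪 n) → ∀ {m y} → Multiple 𝐅 (value ∘ x) m y →
        ∃ λ (y-integral : ∀ j → Integral (y j)) → IteratedSum x m (λ j → y j , y-integral j)
      multiple⇒iteratedSum x one = integral ∘ x , single λ j → ≈⇒≈ₛ refl
      multiple⇒iteratedSum x (add {y = y} {z} multiple z∈𝔪̄ x⊕y≐z) =
        prolong (multiple⇒iteratedSum x multiple)
        where
        z-integral : ∀ j → Integral (z j)
        z-integral j = <⁺⇒≤⁺ (z∈𝔪̄ j)
        prolong : ∃ (λ (y-integral : ∀ j → Integral (y j)) →
                    IteratedSum x _ (λ j → y j , y-integral j)) → _
        prolong (y-integral , s) = z-integral , extend s λ j →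
          let N₀ , limit = eval-limit xy (F j) (z j , z-integral j) (x⊕y≐z j)
          in N₀ , λ N N₀≤N → Q.trans (eval-congˡ {N = N} {x ++ y′} {xy} (F j) agree) (limit N N₀≤N)
          where
          y′ : Vector 𝒪 n
          y′ j = y j , y-integral j
          xy-integral : ∀ k → Integral (((value ∘ x) ++ y) k)
          xy-integral k with splitAt n k
          ... | inj₁ i = integral (x i)
          ... | inj₂ i = y-integral i
          xy : Vector 𝒪 (n ℕ.+ n)
          xy k = ((value ∘ x) ++ y) k , xy-integral k
          value-++ : ∀ k → value ((x ++ y′) k) ≡ ((value ∘ x) ++ y) k
          value-++ k with splitAt n k
          ... | inj₁ _ = ≡.refl
          ... | inj₂ _ = ≡.refl
          agree : ∀ k → (x ++ y′) k ≈ₛ xy k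
          agree k = ≈⇒≈ₛ (reflexive (value-++ k))

-- Newton polygon of multiplication by p

-- Bézout for p and the non-zero remainder of x. Over ℕ the identity comes in two forms, which give
-- the two signs of the inverse.
inverse-mod : ∀ {p} → Prime p → ∀ {x} → ¬ + p ℤ.∣ x → ∃ λ w → w ℤ.* x ≈ + 1 [mod p ]
inverse-mod {p} p-prime {x} p∤x = go (x %ℕ p) (n%ℕd<d x p) (a≡a%ℕn+[a/ℕn]*n x p)
  where
  instance
    p≢0 : ℕ.NonZero p
    p≢0 = prime⇒nonZero p-prime
  h P : ℤ
  h = x /ℕ p
  P = + p
  expand⁻ : ∀ b n k P → (ℤ.- b) ℤ.* (n ℤ.+ k ℤ.* P) ℤ.- + 1 ≡ ℤ.- (+ 1 ℤ.+ b ℤ.* n) ℤ.- b ℤ.* k ℤ.* P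
  expand⁻ = ℤSolver.solve-∀
  expand⁺ : ∀ b n k P → b ℤ.* (n ℤ.+ k ℤ.* P) ℤ.- + 1 ≡ b ℤ.* n ℤ.- + 1 ℤ.+ b ℤ.* k ℤ.* P
  expand⁺ = ℤSolver.solve-∀
  collect⁻ : ∀ a b k P → ℤ.- (a ℤ.* P) ℤ.- b ℤ.* k ℤ.* P ≡ (ℤ.- a ℤ.- b ℤ.* k) ℤ.* P
  collect⁻ = ℤSolver.solve-∀
  collect⁺ : ∀ a b k P → (+ 1 ℤ.+ a ℤ.* P) ℤ.- + 1 ℤ.+ b ℤ.* k ℤ.* P ≡ (a ℤ.+ b ℤ.* k) ℤ.* P
  collect⁺ = ℤSolver.solve-∀
  1+*-pos : ∀ b n {z} → 1 ℕ.+ b ℕ.* n ≡ z → + 1 ℤ.+ + b ℤ.* + n ≡ + z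
  1+*-pos b n eq = ≡.trans (≡.cong (λ y → + 1 ℤ.+ y) (≡.sym (ℤ.pos-* b n))) (≡.cong +_ eq)
  go : ∀ r → r < p → x ≡ + r ℤ.+ h ℤ.* P → ∃ λ w → w ℤ.* x ≈ + 1 [mod p ]
  go zero    _   x≡ = contradiction (ℤ.divides h (≡.trans x≡ (ℤ.+-identityˡ _))) p∤x
  go (suc n) r<p x≡ with Coprimality.coprime-Bézout (Coprimality.prime⇒coprime p-prime r<p)
  ... | Bézout.+- a b eq = ℤ.- + b , mod (ℤ.divides (ℤ.- + a ℤ.- + b ℤ.* h) (≡.trans
    (≡.cong (λ y → (ℤ.- + b) ℤ.* y ℤ.- + 1) x≡) (≡.trans (expand⁻ (+ b) (+ suc n) h P) (≡.trans
    (≡.cong (λ y → ℤ.- y ℤ.- + b ℤ.* h ℤ.* P) (≡.trans (1+*-pos b (suc n) eq) (ℤ.pos-* a p)))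
    (collect⁻ (+ a) (+ b) h P)))))
  ... | Bézout.-+ a b eq = + b , mod (ℤ.divides (+ a ℤ.+ + b ℤ.* h) (≡.trans
    (≡.cong (λ y → + b ℤ.* y ℤ.- + 1) x≡) (≡.trans (expand⁺ (+ b) (+ suc n) h P) (≡.trans
    (≡.cong (λ y → y ℤ.- + 1 ℤ.+ + b ℤ.* h ℤ.* P)
      (≡.sym (≡.trans (1+*-pos a p eq) (ℤ.pos-* b (suc n)))))
    (collect⁺ (+ a) (+ b) h P)))))

-- Two-by-two systems whose determinant is a unit modulo p

module _ {c ℓ} (R : CommutativeRing c ℓ) where

  open CommutativeRing R
  open GroupProperties +-group using (//-rightDividesˡ)

  x-y≈z⇒x≈z+y : ∀ x y {z} → x - y ≈ z → x ≈ z + y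
  x-y≈z⇒x≈z+y x y x-y≈z = trans (sym (//-rightDividesˡ y x)) (+-congʳ x-y≈z)

  determinant : (a b c d : Carrier) → Carrier
  determinant a b c d = a * d - b * c

  1-_∙_ : Carrier → Carrier → Carrier
  1- w ∙ u = 1# - w * u

  -- This says that u is a unit modulo ϖ. It suffices because ϖ will already kill the unknowns, so
  -- no inverse of u in ℤ_p has to be constructed.
  record Coprime (ϖ u : Carrier) : Set (c ⊔ ℓ) where
    field
      {r w}  : Carrier
      bezout : 1# ≈ r * ϖ + w * u

  coprime : ∀ {ϖ u k} w → 1- w ∙ u ≈ ϖ * k → Coprime ϖ u
  coprime {ϖ} {u} {k} w 1-wu≈ϖk = record
    { bezout = x-y≈z⇒x≈z+y 1# (w * u) (trans 1-wu≈ϖk (*-comm ϖ k)) }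

module Linear {c₁ ℓ₁ c₂ ℓ₂} (R : CommutativeRing c₁ ℓ₁) (S : CommutativeRing c₂ ℓ₂)
  (φ : CommutativeRing.Carrier R → CommutativeRing.Carrier S)
  (φ-isHomomorphism : SemiringMorphisms.IsSemiringHomomorphism
     (Semiring.rawSemiring (CommutativeRing.semiring R))
     (Semiring.rawSemiring (CommutativeRing.semiring S)) φ)
  where

  private module R = CommutativeRing R
  open CommutativeRing S
  open SemiringMorphisms.IsSemiringHomomorphism φ-isHomomorphism
  open GroupProperties +-group using (∙-cancelʳ)
  open import Relation.Binary.Reasoning.Setoid setoid

  private
    -- Cramer's rule: d times the first row and b times the second share the summand dby, which is
    -- cancelled.
    eliminate : ∀ {a b c d x y} → a * x + b * y ≈ 0# → c * x + d * y ≈ 0# →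
                (a * d) * x ≈ (b * c) * x
    eliminate {a} {b} {c} {d} {x} {y} row₀ row₁ = ∙-cancelʳ ((d * b) * y) _ _ (begin
      (a * d) * x + (d * b) * y
        ≈⟨ +-cong (trans (*-congʳ (*-comm a d)) (*-assoc d a x)) (*-assoc d b y) ⟩
      d * (a * x) + d * (b * y)  ≈⟨ distribˡ d _ _ ⟨
      d * (a * x + b * y)        ≈⟨ trans (*-congˡ row₀) (zeroʳ d) ⟩
      0#                         ≈⟨ trans (*-congˡ row₁) (zeroʳ b) ⟨
      b * (c * x + d * y)        ≈⟨ distribˡ b _ _ ⟩
      b * (c * x) + b * (d * y)
        ≈⟨ +-cong (*-assoc b c x) (trans (*-congʳ (*-comm d b)) (*-assoc b d y)) ⟨
      (b * c) * x + (d * b) * y  ∎)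

    kill : ∀ r s x → φ s * x ≈ 0# → φ (r R.* s) * x ≈ 0#
    kill r s x sx≈0 = trans (*-congʳ (*-homo r s))
      (trans (*-assoc _ _ x) (trans (*-congˡ sx≈0) (zeroʳ _)))

    -- `φ` is assumed to be a homomorphism of semirings only, so the difference is reached by adding
    -- φ(-s) x to both sides.
    difference-kills : ∀ r s x → φ r * x ≈ φ s * x → φ (r R.- s) * x ≈ 0#
    difference-kills r s x rx≈sx = begin
      φ (r R.- s) * x              ≈⟨ *-congʳ (+-homo r (R.- s)) ⟩
      (φ r + φ (R.- s)) * x        ≈⟨ distribʳ x _ _ ⟩
      φ r * x + φ (R.- s) * x      ≈⟨ +-congʳ rx≈sx ⟩
      φ s * x + φ (R.- s) * x      ≈⟨ distribʳ x _ _ ⟨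
      (φ s + φ (R.- s)) * x        ≈⟨ *-congʳ (+-homo s (R.- s)) ⟨
      φ (s R.- s) * x              ≈⟨ *-congʳ (trans (⟦⟧-cong (R.-‿inverseʳ s)) 0#-homo) ⟩
      0# * x                       ≈⟨ zeroˡ x ⟩
      0#                           ∎

    unit-kills : ∀ {u ϖ k w x} → R.1# R.≈ k R.* ϖ R.+ w R.* u →
                 φ u * x ≈ 0# → φ ϖ * x ≈ 0# → x ≈ 0#
    unit-kills {u} {ϖ} {k} {w} {x} bezout ux≈0 ϖx≈0 = begin
      x                               ≈⟨ *-identityˡ x ⟨
      1# * x                          ≈⟨ *-congʳ (trans (sym 1#-homo) (⟦⟧-cong bezout)) ⟩
      φ (k R.* ϖ R.+ w R.* u) * x     ≈⟨ trans (*-congʳ (+-homo _ _)) (distribʳ x _ _) ⟩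
      φ (k R.* ϖ) * x + φ (w R.* u) * x ≈⟨ +-cong (kill k ϖ x ϖx≈0) (kill w u x ux≈0) ⟩
      0# + 0#                         ≈⟨ +-identityˡ 0# ⟩
      0#                              ∎

  difference-kills⇒≈ : ∀ {r s x} → φ (r R.- s) * x ≈ 0# → φ r * x ≈ φ s * x
  difference-kills⇒≈ {r} {s} {x} kills = begin
    φ r * x                      ≈⟨ *-congʳ (trans (⟦⟧-cong (x-y≈z⇒x≈z+y R r s R.refl)) (+-homo _ s)) ⟩
    (φ (r R.- s) + φ s) * x      ≈⟨ distribʳ x _ _ ⟩
    φ (r R.- s) * x + φ s * x    ≈⟨ trans (+-congʳ kills) (+-identityˡ _) ⟩
    φ s * x                      ∎

  module _ {ϖ a b c d x y} (unimodular : Coprime R ϖ (determinant R a b c d))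
    (row₀ : φ a * x + φ b * y ≈ 0#) (row₁ : φ c * x + φ d * y ≈ 0#)
    where

    open Coprime unimodular using (bezout)

    unimodular⇒x≈0 : φ ϖ * x ≈ 0# → x ≈ 0#
    unimodular⇒x≈0 = unit-kills bezout (difference-kills (a R.* d) (b R.* c) x
      (trans (*-congʳ (*-homo a d)) (trans (eliminate row₀ row₁) (*-congʳ (sym (*-homo b c))))))

    unimodular⇒y≈0 : φ ϖ * y ≈ 0# → y ≈ 0#
    unimodular⇒y≈0 = unit-kills bezout (difference-kills (a R.* d) (b R.* c) y (begin
      φ (a R.* d) * y  ≈⟨ *-congʳ (trans (*-homo a d) (*-comm _ _)) ⟩
      -- Reversing both rows and columns preserves the determinant and puts y in the place of x.
      φ d * φ a * y    ≈⟨ eliminate (trans (+-comm _ _) row₁) (trans (+-comm _ _) row₀) ⟩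
      φ c * φ b * y    ≈⟨ *-congʳ (trans (*-homo b c) (*-comm _ _)) ⟨
      φ (b R.* c) * y  ∎))

module Newton {p c ℓ₁ ℓ₂} (p-prime : Prime p) (K : ValuedAlgebraicClosure p c ℓ₁ ℓ₂) where

  private
    instance
      p≢0 : ℕ.NonZero p
      p≢0 = prime⇒nonZero p-prime
    module ℤₚ = CommutativeRing (ℤₚ p)
    module K = CommutativeRing (ValuedAlgebraicClosure.commutativeRing K)

  open Valuation K
  open ValuedAlgebraicClosure K using (ι; ι-isHomomorphism; v; v-cong; v-ℤₚ; v-p; _·_)
  open RingMorphisms.IsRingHomomorphism ι-isHomomorphism

  ι-ℕ : ∀ n → ι (constₚ (+ n)) K.≈ n · K.1#
  ι-ℕ zero    = 0#-homo
  ι-ℕ (suc n) = K.trans (⟦⟧-cong 1+n≈)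
    (K.trans (+-homo ℤₚ.1# (constₚ (+ n))) (K.+-cong 1#-homo (ι-ℕ n)))
    where
    1+n≈ : constₚ (+ suc n) ℤₚ.≈ ℤₚ.1# ℤₚ.+ constₚ (+ n)
    1+n≈ = levelwise λ _ → ≡⇒≈mod ≡.refl

  v-ιp : v (ι (constₚ (+ p))) ≡ [ 1ℚ ]
  v-ιp = ≡.trans (v-cong (ι-ℕ p)) v-p

  1≤v-ιp : [ 1ℚ ] ≤⁺ v (ι (constₚ (+ p)))
  1≤v-ιp = ≡.subst ([ 1ℚ ] ≤⁺_) (≡.sym v-ιp) [ ℚ.≤-refl ]

  v-ι-p* : ∀ {k a} w → a ≈ₚ (constₚ (+ p) *ₚ w) → [ k ×ℚ 1ℚ ] ≤⁺ v (ι w) → [ suc k ×ℚ 1ℚ ] ≤⁺ v (ι a)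
  v-ι-p* {k} {a} w a≈pw k≤w = ≡.subst ([ suc k ×ℚ 1ℚ ] ≤⁺_) (≡.sym (v-cong ιa≈))
    (v-≥-* {x = ι (constₚ (+ p))} {ι w} 1≤v-ιp k≤w)
    where
    ιa≈ : ι a K.≈ ι (constₚ (+ p)) K.* ι w
    ιa≈ = K.trans {ι a} {ι (constₚ (+ p) *ₚ w)} (⟦⟧-cong a≈pw) (*-homo (constₚ (+ p)) w)

  -- Each factor p split off by `p-divides` contributes 1 to the valuation, and what remains is
  -- again in ℤ_p.
  v-ι-≥ : ∀ k a → approx a k ≈ + 0 [mod p ℕ.^ k ] → [ k ×ℚ 1ℚ ] ≤⁺ v (ι a)
  v-ι-≥ zero    a _    = v-ℤₚ a
  v-ι-≥ (suc k) a aₖ≈0 = bound (p-divides a k aₖ≈0)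
    where
    bound : (∃ λ w → (a ≈ₚ (constₚ (+ p) *ₚ w)) × approx w k ≈ + 0 [mod p ℕ.^ k ]) →
            [ suc k ×ℚ 1ℚ ] ≤⁺ v (ι a)
    bound (w , a≈pw , wₖ≈0) = v-ι-p* {k} {a} w a≈pw (v-ι-≥ k w wₖ≈0)

  -- If w inverts u modulo p, then 1 - wu is divisible by p in ℤ_p, which is the required Bézout
  -- relation.
  unit⇒coprime : ∀ u → ¬ + p ℤ.∣ approx u 1 → Coprime (ℤₚ p) (constₚ (+ p)) u
  unit⇒coprime u p∤u = lift (inverse-mod p-prime p∤u)
    where
    remainder : ℤ → PAdic p
    remainder w = (1-_∙_) (ℤₚ p) (constₚ w) u
    solve : ∀ w → (∃ λ k → (remainder w ≈ₚ (constₚ (+ p) *ₚ k)) × approx k 0 ≈ + 0 [mod p ℕ.^ 0 ]) →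
            Coprime (ℤₚ p) (constₚ (+ p)) u
    solve w (k , 1-wu≈pk , _) = coprime (ℤₚ p) {constₚ (+ p)} {u} {k} (constₚ w) 1-wu≈pk
    lift : (∃ λ w → w ℤ.* approx u 1 ≈ + 1 [mod p ]) → Coprime (ℤₚ p) (constₚ (+ p)) u
    lift (w , wu≈1) = solve w (p-divides (remainder w) 0
      (≡.subst (λ m → + 1 ℤ.- w ℤ.* approx u 1 ≈ + 0 [mod m ]) (≡.sym (ℕ.^-identityʳ p))
        (∣⇒≈0 (difference (≈mod-sym wu≈1)))))

-- With μ = min(v x₀, v x₁), the only terms of f(x₀, x₁) that can have valuation at
-- most min(1 + μ, qμ) are p xᵢ and those in x₀^q, x₁^q. Modulo the elements of
-- larger valuation either kind can be isolated unless 1 + μ = qμ.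
module NewtonPolygon {p c ℓ₁ ℓ₂} (p-prime : Prime p) (K : ValuedAlgebraicClosure p c ℓ₁ ℓ₂)
  {q} (1<q : 1 < q) (f : Fin 2 → Vec ℕ 2 → PAdic p)
  (f-zeros : ∀ i → f i (0 ∷ 0 ∷ []) ≈ₚ constₚ (+ 0))
  (f-linear : ∀ i j → approx (f i (unit j)) 2 ≈ + p ℤ.* + lookup (unit j) i [mod p ℕ.^ 2 ])
  (f-powers : ∀ i e → ¬ All (q ℕ.∣_) e → approx (f i e) 1 ≈ + 0 [mod p ℕ.^ 1 ])
  (P : Vector (ValuedAlgebraicClosure.Carrier K) 2) {μ} (0<μ : 0ℚ ℚ.< μ)
  (μ≤P : ∀ i → [ μ ] ≤⁺ ValuedAlgebraicClosure.v K (P i))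
  where

  private
    module ℤₚ = CommutativeRing (ℤₚ p)
    H V : Vec ℕ 2
    H = horizontal q
    V = vertical q

    ϖ : PAdic p
    ϖ = constₚ (+ p)

  open Valuation K
  open Newton p-prime K
  open ValuedAlgebraicClosure K using (ι; v; v-*; v-ℤₚ)

  module _ {s} (s≤1+μ : s ℚ.≤ 1ℚ ℚ.+ μ) (s≤qμ : s ℚ.≤ q ×ℚ μ) where

    open Modulo s
    private module Q = CommutativeRing quotientRing
    open Monomials (Semiring.rawSemiring Q.semiring) using () renaming (_^_ to _^Q_; _^^_ to _^^Q_)
    open SemiringMorphisms.IsSemiringHomomorphism ιₛ-isHomomorphism
      using () renaming (⟦⟧-cong to ιₛ-cong; 0#-homo to ιₛ-0)
    open Evaluation (ℤₚ p) quotientRing ιₛ ιₛ-isHomomorphism using (eval; ^^-unit)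
    open Linear (ℤₚ p) quotientRing ιₛ ιₛ-isHomomorphism using (difference-kills⇒≈)
    open BoxSums quotientRing using (∑≤-support)
    open import Relation.Binary.Reasoning.Setoid Q.setoid

    x : Vector 𝒪 2
    x i = P i , ≤⁺-trans ℚ.≤-trans [ ℚ.<⇒≤ 0<μ ] (μ≤P i)

    term : Fin 2 → Vec ℕ 2 → 𝒪
    term i e = ιₛ (f i e) Q.* x ^^Q e

    v-x^^ : ∀ e → [ degree e ×ℚ μ ] ≤⁺ v (value (x ^^Q e))
    v-x^^ e = ≡.subst (λ y → [ degree e ×ℚ μ ] ≤⁺ v y) (≡.sym (value-^^ x e)) (v-^^-≥ μ≤P e)

    term-small : ∀ {b} i e → [ b ] ≤⁺ v (ι (f i e)) → s ℚ.< b ℚ.+ degree e ×ℚ μ → term i e ≈ₛ Q.0#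
    term-small i e b≤f s<b+deg = small⇒≈0 (<⁺-≤⁺-trans s<b+deg (v-≥-* b≤f (v-x^^ e)))

    s<2+μ : s ℚ.< 2 ×ℚ 1ℚ ℚ.+ μ
    s<2+μ = ℚ.≤-<-trans s≤1+μ (ℚ.+-monoˡ-< μ {1ℚ} {2 ×ℚ 1ℚ} (<-+ʳ 0<1))

    -- The coefficient is known modulo p², so replacing it changes the term by valuation at least 2
    -- + μ, which exceeds s.
    term-linear : ∀ i j → term i (unit j) ≈ₛ ιₛ (constₚ (+ p ℤ.* + lookup (unit j) i)) Q.* x j
    term-linear i j = Q.trans (Q.*-congˡ {ιₛ (f i (unit j))} (^^-unit x j))
      (difference-kills⇒≈ {f i (unit j)} {δ} {x j} (small⇒≈0 {ιₛ (f i (unit j) ℤₚ.- δ) Q.* x j}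
        (<⁺-≤⁺-trans s<2+μ (v-≥-* (v-ι-≥ 2 _ (∣⇒≈0 (difference (f-linear i j)))) (μ≤P j)))))
      where
      δ : PAdic p
      δ = constₚ (+ p ℤ.* + lookup (unit j) i)

    term-H : ∀ i → term i H ≈ₛ ιₛ (f i H) Q.* x 0F ^Q q
    term-H i = Q.*-congˡ {ιₛ (f i H)}
      (Q.trans (Q.*-congˡ {x 0F ^Q q} (Q.*-identityˡ Q.1#)) (Q.*-identityʳ (x 0F ^Q q)))

    term-V : ∀ i → term i V ≈ₛ ιₛ (f i V) Q.* x 1F ^Q q
    term-V i = Q.*-congˡ {ιₛ (f i V)}
      (Q.trans (Q.*-identityˡ (x 1F ^Q q Q.* Q.1#)) (Q.*-identityʳ (x 1F ^Q q)))

    vertices : List (Vec ℕ 2)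
    vertices = unit 0F ∷ unit 1F ∷ H ∷ V ∷ []

    q<2q+ : ∀ a → q < q ℕ.+ (q ℕ.+ a ℕ.* q)
    q<2q+ a = ℕ.m<m+n q (ℕ.<-≤-trans (ℕ.<-trans (s≤s z≤n) 1<q) (ℕ.m≤m+n q (a ℕ.* q)))

    -- The exponent is (aq, bq), and a + b ≤ 1 would make it the origin, `H` or `V`; so its degree
    -- is at least 2q.
    q∣⇒q<degree : ∀ {e} → All (q ℕ.∣_) e → 0 < degree e → e ∉ vertices → q < degree e
    q∣⇒q<degree (ℕ.divides-refl 0 ∷ ℕ.divides-refl 0 ∷ []) () e∉
    q∣⇒q<degree (ℕ.divides-refl 1 ∷ ℕ.divides-refl 0 ∷ []) _ e∉ =
      contradiction (there (there (here (≡.cong (λ z → z ∷ 0 ∷ []) (ℕ.+-identityʳ q))))) e∉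
    q∣⇒q<degree (ℕ.divides-refl 0 ∷ ℕ.divides-refl 1 ∷ []) _ e∉ =
      contradiction (there (there (there (here (≡.cong (λ z → 0 ∷ z ∷ []) (ℕ.+-identityʳ q)))))) e∉
    q∣⇒q<degree (ℕ.divides-refl (suc a) ∷ ℕ.divides-refl (suc b) ∷ []) _ _ =
      ℕ.≤-<-trans (ℕ.m≤m+n q (a ℕ.* q)) (ℕ.m<m+n _
        (ℕ.<-≤-trans (ℕ.<-trans (s≤s z≤n) 1<q) (ℕ.≤-trans (ℕ.m≤m+n q (b ℕ.* q)) (ℕ.m≤m+n _ 0))))
    q∣⇒q<degree (ℕ.divides-refl (suc (suc a)) ∷ ℕ.divides-refl 0 ∷ []) _ _ =
      ℕ.<-≤-trans (q<2q+ a) (ℕ.m≤m+n _ 0)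
    q∣⇒q<degree (ℕ.divides-refl 0 ∷ ℕ.divides-refl (suc (suc b)) ∷ []) _ _ =
      ℕ.<-≤-trans (q<2q+ b) (ℕ.m≤m+n _ 0)

    -- If q divides the exponent, its degree exceeds q and the monomial alone has valuation above
    -- qμ. Otherwise the coefficient is divisible by p, and degree at least 2 gives valuation at
    -- least 1 + 2μ > 1 + μ.
    term-high : ∀ i e → 1 < degree e → e ∉ vertices → term i e ≈ₛ Q.0#
    term-high i e 1<deg e∉ with VecAll.all? (q ℕ.∣?_) e
    ... | yes q∣e = term-small i e (v-ℤₚ (f i e)) (≡.subst (s ℚ.<_)
      (≡.sym (ℚ.+-identityˡ (degree e ×ℚ μ))) (ℚ.≤-<-trans s≤qμ
        (×ℚ-monoˡ-< {q} {degree e} 0<μ (q∣⇒q<degree q∣e (ℕ.<-trans (s≤s z≤n) 1<deg) e∉))))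
    ... | no  q∤e = term-small i e (v-ι-≥ 1 (f i e) (f-powers i e q∤e)) (ℚ.≤-<-trans s≤1+μ
      (ℚ.+-monoʳ-< 1ℚ (≡.subst (ℚ._< degree e ×ℚ μ) (ℚ.+-identityʳ μ)
        (×ℚ-monoˡ-< {1} {degree e} 0<μ 1<deg))))

    term-other : ∀ i e → e ∉ vertices → term i e ≈ₛ Q.0#
    term-other i (0 ∷ 0 ∷ []) _ = Q.trans
      (Q.*-congʳ {x ^^Q (0 ∷ 0 ∷ [])} (Q.trans (ιₛ-cong (f-zeros i)) ιₛ-0))
      (Q.zeroˡ (x ^^Q (0 ∷ 0 ∷ [])))
    term-other i (1 ∷ 0 ∷ []) e∉ = contradiction (here ≡.refl) e∉
    term-other i (0 ∷ 1 ∷ []) e∉ = contradiction (there (here ≡.refl)) e∉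
    term-other i e@(0 ∷ suc (suc b) ∷ []) e∉ = term-high i e (s≤s (s≤s z≤n)) e∉
    term-other i e@(suc (suc a) ∷ b ∷ [])  e∉ = term-high i e (s≤s (s≤s z≤n)) e∉
    term-other i e@(1 ∷ suc b ∷ []) e∉ = term-high i e (s≤s (s≤s z≤n)) e∉

    vertices-unique : Unique vertices
    vertices-unique =
      ((λ ()) ∷ (λ eq → ℕ.<⇒≢ 1<q (∷-injectiveˡ eq)) ∷ (λ ()) ∷ []) ∷
      ((λ ()) ∷ (λ eq → ℕ.<⇒≢ 1<q (∷-injectiveˡ (∷-injectiveʳ eq))) ∷ []) ∷
      ((λ eq → ℕ.<⇒≢ (ℕ.<-trans (s≤s z≤n) 1<q) (≡.sym (∷-injectiveˡ eq))) ∷ []) ∷ [] ∷ []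

    expansion : ∀ {N} → q ≤ N → ∀ i → eval N x (f i) ≈ₛ
      ιₛ ϖ Q.* x i Q.+ (ιₛ (f i H) Q.* x 0F ^Q q Q.+ ιₛ (f i V) Q.* x 1F ^Q q)
    expansion {N} q≤N i = begin
      eval N x (f i)
        ≈⟨ ∑≤-support (replicate 2 N) (term i) vertices vertices-unique bounds
             (λ e _ → term-other i e) ⟩
      term i (unit 0F) Q.+ (term i (unit 1F) Q.+ (term i H Q.+ (term i V Q.+ Q.0#)))
        ≈⟨ Q.+-assoc (term i (unit 0F)) (term i (unit 1F)) (term i H Q.+ (term i V Q.+ Q.0#)) ⟨
      (term i (unit 0F) Q.+ term i (unit 1F)) Q.+ (term i H Q.+ (term i V Q.+ Q.0#))
        ≈⟨ Q.+-cong (diagonal i) (Q.+-cong (term-H i) (Q.trans (Q.+-identityʳ (term i V)) (term-V i))) ⟩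
      ιₛ ϖ Q.* x i Q.+ (ιₛ (f i H) Q.* x 0F ^Q q Q.+ ιₛ (f i V) Q.* x 1F ^Q q) ∎
      where
      1≤N : 1 ≤ N
      1≤N = ℕ.≤-trans (ℕ.<⇒≤ 1<q) q≤N
      bounds : ListAll.All (_≤ᵛ replicate 2 N) vertices
      bounds = (1≤N ∷ z≤n ∷ []) ∷ (z≤n ∷ 1≤N ∷ []) ∷ (q≤N ∷ z≤n ∷ []) ∷ (z≤n ∷ q≤N ∷ []) ∷ []
      on : ∀ j → ιₛ (constₚ (+ p ℤ.* + 1)) Q.* x j ≈ₛ ιₛ ϖ Q.* x j
      on j = Q.*-congʳ {x j} (ιₛ-cong (levelwise λ _ → ≡⇒≈mod (ℤ.*-identityʳ (+ p))))
      off : ∀ j → ιₛ (constₚ (+ p ℤ.* + 0)) Q.* x j ≈ₛ Q.0#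
      off j = Q.trans
                (Q.*-congʳ {x j} (Q.trans (ιₛ-cong (levelwise λ _ → ≡⇒≈mod (ℤ.*-zeroʳ (+ p)))) ιₛ-0))
                (Q.zeroˡ (x j))
      diagonal : ∀ i → term i (unit 0F) Q.+ term i (unit 1F) ≈ₛ ιₛ ϖ Q.* x i
      diagonal 0F = Q.trans (Q.+-cong (Q.trans (term-linear 0F 0F) (on 0F))
                                      (Q.trans (term-linear 0F 1F) (off 1F)))
                      (Q.+-identityʳ (ιₛ ϖ Q.* x 0F))
      diagonal 1F = Q.trans (Q.+-cong (Q.trans (term-linear 1F 0F) (off 0F))
                                      (Q.trans (term-linear 1F 1F) (on 1F)))
                      (Q.+-identityˡ (ιₛ ϖ Q.* x 1F))

    -- A single truncation is enough, since `expansion` holds for every side N ≥ q; from there on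
    -- the box contains all four vertices.
    Root : Set _
    Root = ∃ λ N → q ≤ N × ∀ i → eval N x (f i) ≈ₛ Q.0#

    v-x^q : ∀ j → [ q ×ℚ μ ] ≤⁺ v (value (x j ^Q q))
    v-x^q j = ≡.subst (λ y → [ q ×ℚ μ ] ≤⁺ v y) (≡.sym (value-^ (x j) q)) (v-^-≥ (μ≤P j) q)

    root⇒row≈0 : Root → ∀ i →
      ιₛ ϖ Q.* x i Q.+ (ιₛ (f i H) Q.* x 0F ^Q q Q.+ ιₛ (f i V) Q.* x 1F ^Q q) ≈ₛ Q.0#
    root⇒row≈0 (N , q≤N , f≈0) i = Q.trans (Q.sym (expansion q≤N i)) (f≈0 i)

    -- Since qμ exceeds s, the q-th powers vanish and p xᵢ ≈ 0 remains. At a coordinate that attains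
    -- μ, however, p xᵢ has valuation exactly 1 + μ = s.
    low-slope-impossible : s ≡ 1ℚ ℚ.+ μ → s ℚ.< q ×ℚ μ → Root → ∀ {i} → ¬ v (P i) ≡ [ μ ]
    low-slope-impossible ≡.refl s<qμ root {i} vPi≡μ = <⁺-irrefl
      (≡.trans (v-* (ι ϖ) (P i)) (≡.cong₂ _+⁺_ v-ιp vPi≡μ)) (≈0⇒small ϖx≈0)
      where
      power≈0 : ∀ j a → ιₛ a Q.* x j ^Q q ≈ₛ Q.0#
      power≈0 j a = Q.trans
        (Q.*-congˡ {ιₛ a} (small⇒≈0 {x j ^Q q} (<⁺-≤⁺-trans s<qμ (v-x^q j)))) (Q.zeroʳ (ιₛ a))
      ϖx≈0 : ιₛ ϖ Q.* x i ≈ₛ Q.0#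
      ϖx≈0 = begin
        ιₛ ϖ Q.* x i                         ≈⟨ Q.+-identityʳ (ιₛ ϖ Q.* x i) ⟨
        ιₛ ϖ Q.* x i Q.+ Q.0#                ≈⟨ Q.+-congˡ {ιₛ ϖ Q.* x i} (Q.+-identityˡ Q.0#) ⟨
        ιₛ ϖ Q.* x i Q.+ (Q.0# Q.+ Q.0#)
          ≈⟨ Q.+-congˡ {ιₛ ϖ Q.* x i} (Q.+-cong (power≈0 0F (f i H)) (power≈0 1F (f i V))) ⟨
        ιₛ ϖ Q.* x i Q.+ (ιₛ (f i H) Q.* x 0F ^Q q Q.+ ιₛ (f i V) Q.* x 1F ^Q q)
          ≈⟨ root⇒row≈0 root i ⟩
        Q.0# ∎

    -- Since 1 + μ exceeds s, the terms p xᵢ vanish, and the remaining linear system in the q-th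
    -- powers forces these to vanish. At a coordinate that attains μ, however, the q-th power has
    -- valuation exactly qμ = s.
    high-slope-impossible : Coprime (ℤₚ p) ϖ (determinant (ℤₚ p) (f 0F H) (f 0F V) (f 1F H) (f 1F V)) →
      s ≡ q ×ℚ μ → s ℚ.< 1ℚ ℚ.+ μ → Root → ∀ {i} → ¬ v (P i) ≡ [ μ ]
    high-slope-impossible f-unimodular ≡.refl s<1+μ root {i} vPi≡μ = <⁺-irrefl
      (≡.trans (≡.cong v (value-^ (x i) q)) (v-^ vPi≡μ q)) (≈0⇒small (x^q≈0 i))
      where
      row≈0 : ∀ i → ιₛ (f i H) Q.* x 0F ^Q q Q.+ ιₛ (f i V) Q.* x 1F ^Q q ≈ₛ Q.0#
      row≈0 i = begin
        ιₛ (f i H) Q.* x 0F ^Q q Q.+ ιₛ (f i V) Q.* x 1F ^Q q         ≈⟨ Q.+-identityˡ _ ⟨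
        Q.0# Q.+ (ιₛ (f i H) Q.* x 0F ^Q q Q.+ ιₛ (f i V) Q.* x 1F ^Q q)
          ≈⟨ Q.+-congʳ {ιₛ (f i H) Q.* x 0F ^Q q Q.+ ιₛ (f i V) Q.* x 1F ^Q q}
               (small⇒≈0 {ιₛ ϖ Q.* x i} (<⁺-≤⁺-trans s<1+μ (v-≥-* 1≤v-ιp (μ≤P i)))) ⟨
        ιₛ ϖ Q.* x i Q.+ (ιₛ (f i H) Q.* x 0F ^Q q Q.+ ιₛ (f i V) Q.* x 1F ^Q q)
          ≈⟨ root⇒row≈0 root i ⟩
        Q.0# ∎
      s<1+s : s ℚ.< 1ℚ ℚ.+ s
      s<1+s = ≡.subst (s ℚ.<_) (ℚ.+-comm s 1ℚ) (<-+ʳ 0<1)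
      -- p kills the q-th powers because 1 + qμ > s; this is why a determinant that is a unit modulo
      -- p is enough.
      ϖx^q≈0 : ∀ j → ιₛ ϖ Q.* x j ^Q q ≈ₛ Q.0#
      ϖx^q≈0 j = small⇒≈0 (<⁺-≤⁺-trans s<1+s (v-≥-* 1≤v-ιp (v-x^q j)))
      open Linear (ℤₚ p) quotientRing ιₛ ιₛ-isHomomorphism using (unimodular⇒x≈0; unimodular⇒y≈0)
      x^q≈0 : ∀ j → x j ^Q q ≈ₛ Q.0#
      x^q≈0 0F = unimodular⇒x≈0
        {ϖ} {f 0F H} {f 0F V} {f 1F H} {f 1F V} {x 0F ^Q q} {x 1F ^Q q}
        f-unimodular (row≈0 0F) (row≈0 1F) (ϖx^q≈0 0F)
      x^q≈0 1F = unimodular⇒y≈0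
        {ϖ} {f 0F H} {f 0F V} {f 1F H} {f 1F V} {x 0F ^Q q} {x 1F ^Q q}
        f-unimodular (row≈0 0F) (row≈0 1F) (ϖx^q≈0 1F)

  -- The modulus s depends on which of 1 + μ and qμ is smaller, so the root is requested for every
  -- admissible s.
  slope : Coprime (ℤₚ p) ϖ (determinant (ℤₚ p) (f 0F H) (f 0F V) (f 1F H) (f 1F V)) →
          (∀ s (s≤1+μ : s ℚ.≤ 1ℚ ℚ.+ μ) (s≤qμ : s ℚ.≤ q ×ℚ μ) → Root {s} s≤1+μ s≤qμ) →
          ∀ i → v (P i) ≡ [ μ ] → q ×ℚ μ ≡ 1ℚ ℚ.+ μ
  slope f-unimodular roots i vPi≡μ = by-cases (ℚ.<-cmp (1ℚ ℚ.+ μ) (q ×ℚ μ))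
    where
    low : 1ℚ ℚ.+ μ ℚ.< q ×ℚ μ → ⊥
    low 1+μ<qμ = low-slope-impossible {1ℚ ℚ.+ μ} ≤₁ ≤₂ ≡.refl 1+μ<qμ (roots _ ≤₁ ≤₂) {i} vPi≡μ
      where
      ≤₁ : 1ℚ ℚ.+ μ ℚ.≤ 1ℚ ℚ.+ μ
      ≤₁ = ℚ.≤-refl
      ≤₂ : 1ℚ ℚ.+ μ ℚ.≤ q ×ℚ μ
      ≤₂ = ℚ.<⇒≤ 1+μ<qμ
    high : q ×ℚ μ ℚ.< 1ℚ ℚ.+ μ → ⊥
    high qμ<1+μ = high-slope-impossible {q ×ℚ μ} ≤₁ ≤₂ f-unimodular ≡.refl qμ<1+μ
      (roots _ ≤₁ ≤₂) {i} vPi≡μ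
      where
      ≤₁ : q ×ℚ μ ℚ.≤ 1ℚ ℚ.+ μ
      ≤₁ = ℚ.<⇒≤ qμ<1+μ
      ≤₂ : q ×ℚ μ ℚ.≤ q ×ℚ μ
      ≤₂ = ℚ.≤-refl
    by-cases : Tri (1ℚ ℚ.+ μ ℚ.< q ×ℚ μ) (1ℚ ℚ.+ μ ≡ q ×ℚ μ) (q ×ℚ μ ℚ.< 1ℚ ℚ.+ μ) → q ×ℚ μ ≡ 1ℚ ℚ.+ μ
    by-cases (tri≈ _ 1+μ≡qμ _) = ≡.sym 1+μ≡qμ
    by-cases (tri< 1+μ<qμ _ _) = ⊥-elim (low 1+μ<qμ)
    by-cases (tri> _ _ qμ<1+μ) = ⊥-elim (high qμ<1+μ)

-- The slope argument needs a coordinate of valuation exactly μ, so the minimum comes with one that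
-- attains it. The other coordinate may be zero, of valuation ⊤⁺.
finite-minimum : ∀ {a b} → [ 0ℚ ] <⁺ a → [ 0ℚ ] <⁺ b → ¬ (a ≡ ⊤⁺ × b ≡ ⊤⁺) →
  ∃ λ μ → 0ℚ ℚ.< μ × a ⊓⁺ b ≡ [ μ ] × [ μ ] ≤⁺ a × [ μ ] ≤⁺ b × (a ≡ [ μ ] ⊎ b ≡ [ μ ])
finite-minimum {[ a ]} {[ b ]} [ 0<a ] [ 0<b ] _ with ℚ.⊓-sel a b
... | inj₁ eq =
  a , 0<a , ≡.cong [_] eq , [ ℚ.≤-refl ] , [ ≡.subst (ℚ._≤ b) eq (ℚ.p⊓q≤q a b) ] , inj₁ ≡.refl
... | inj₂ eq =
  b , 0<b , ≡.cong [_] eq , [ ≡.subst (ℚ._≤ a) eq (ℚ.p⊓q≤p a b) ] , [ ℚ.≤-refl ] , inj₂ ≡.refl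
finite-minimum {[ a ]} {⊤⁺} [ 0<a ] _ _ = a , 0<a , ≡.refl , [ ℚ.≤-refl ] , (_ ≤⊤⁺) , inj₁ ≡.refl
finite-minimum {⊤⁺} {[ b ]} _ [ 0<b ] _ = b , 0<b , ≡.refl , (_ ≤⊤⁺) , [ ℚ.≤-refl ] , inj₂ ≡.refl
finite-minimum {⊤⁺} {⊤⁺} _ _ ≢⊤ = contradiction (≡.refl , ≡.refl) ≢⊤

theorem4p5 : ∀ (ℓ : ℕ) → Prime ℓ → (2<ℓ : 2 < ℓ) →
    (𝐅 : PowerSeries.FormalGroupLaw (rawℤₚ ℓ) 2) →
    PowerSeries.Symmetric (rawℤₚ ℓ) 𝐅 →
    HasHeight 𝐅 4 →
    HasExponent 𝐅 2 →
    ∀ {c ℓ₁ ℓ₂} (K : ValuedAlgebraicClosure ℓ c ℓ₁ ℓ₂) →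
    let open ValuedAlgebraicClosure K in
    ∀ (P : Vector Carrier 2) → Torsion 𝐅 ℓ P → ¬ IsZero P →
    v (P 0F) ⊓⁺ v (P 1F) ≡ [ α ℓ 2<ℓ ]
theorem4p5 ℓ ℓ-prime 2<ℓ 𝐅 _ height (inPowers , _) K P torsion P≢0 =
  conclude (finite-minimum (inside 0F) (inside 1F) finite)
  where
  open ValuedAlgebraicClosure K using (v; v-∞; IsZero; Torsion; Multiple)
  open Torsion torsion using (inside; kills)
  open PowerSeries.FormalGroupLaw 𝐅 using (mult)
  open Valuation K
  open Newton ℓ-prime K using (unit⇒coprime)

  instance
    ℓ≢0 : ℕ.NonZero ℓ
    ℓ≢0 = prime⇒nonZero ℓ-prime

  q : ℕ
  q = ℓ ℕ.^ 2

  1<q : 1 < q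
  1<q = ℕ.^-monoˡ-< 2 {1} {ℓ} (ℕ.<-trans (s≤s (s≤s z≤n)) 2<ℓ)

  instance
    q≢0 : ℕ.NonZero q
    q≢0 = ℕ.>-nonZero (ℕ.<-trans (s≤s z≤n) 1<q)
    q∸1≢0 : ℕ.NonZero (q ℕ.∸ 1)
    q∸1≢0 = ℕ.>-nonZero (ℕ.m<n⇒0<n∸m 1<q)

  finite : ¬ (v (P 0F) ≡ ⊤⁺ × v (P 1F) ≡ ⊤⁺)
  finite (v₀≡⊤ , v₁≡⊤) = P≢0 λ { 0F → Equivalence.to (v-∞ _) v₀≡⊤ ; 1F → Equivalence.to (v-∞ _) v₁≡⊤ }

  g : Fin 2 → Vec ℕ 2 → ℤ
  g = reduced[p] 𝐅

  ^1⇒ : ∀ {x y} → x ≈ y [mod ℓ ℕ.^ 1 ] → x ≈ y [mod ℓ ]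
  ^1⇒ = ≡.subst (_ ≈ _ [mod_]) (ℕ.^-identityʳ ℓ)

  mult-0 : ∀ i → mult ℓ i (0 ∷ 0 ∷ []) ≈ₚ constₚ (+ 0)
  mult-0 = MultConstant.mult-zeros (ℤₚ ℓ) 𝐅 ℓ

  q²≡ℓ⁴ : ℓ ℕ.^ 4 ≡ q ℕ.* q
  q²≡ℓ⁴ = ℕ.^-distribˡ-+-* ℓ 2 2

  nonsingular : ¬ + ℓ ℤ.∣ g 0F (horizontal q) ℤ.* g 1F (vertical q) ℤ.-
                          g 0F (vertical q) ℤ.* g 1F (horizontal q)
  nonsingular = Nonsingular.nonsingular ℓ-prime q g inPowers
    (λ i → ^1⇒ (at (mult-0 i) 1)) (ℕ.≤-reflexive q²≡ℓ⁴) height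

  module _ {μ} (0<μ : 0ℚ ℚ.< μ) (μ≤P : ∀ i → [ μ ] ≤⁺ v (P i)) where

    open NewtonPolygon ℓ-prime K {q} 1<q (mult ℓ) mult-0
      (LinearCoefficients.mult-linear 𝐅)
      (λ i e q∤e → ≡.subst (λ m → approx (mult ℓ i e) 1 ≈ + 0 [mod m ]) (≡.sym (ℕ.^-identityʳ ℓ))
        (inPowers i e q∤e))
      P 0<μ μ≤P

    root : ∀ s (s≤1+μ : s ℚ.≤ 1ℚ ℚ.+ μ) (s≤qμ : s ℚ.≤ q ×ℚ μ) → Root {s} s≤1+μ s≤qμ
    root s s≤1+μ s≤qμ = N , ℕ.m≤n+m q D , vanishes (proj₂ kills)
      where
      open Modulo s
      module Q = CommutativeRing quotientRing
      open Evaluation (ℤₚ ℓ) quotientRing ιₛ ιₛ-isHomomorphism using (eval; Nilpotent)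
      open MultEvaluation (ℤₚ ℓ) quotientRing ιₛ ιₛ-isHomomorphism 𝐅 using (eval-mult)
      X : Vector 𝒪 2
      X = x s≤1+μ s≤qμ
      D N : ℕ
      D = proj₁ (nilpotent 0<μ X μ≤P)
      -- N has to reach the nilpotency degree D for `eval-mult` and q for `expansion`.
      N = D ℕ.+ q
      X-nilpotent : Nilpotent D X
      X-nilpotent = proj₂ (nilpotent 0<μ X μ≤P)
      z : Vector (ValuedAlgebraicClosure.Carrier K) 2
      z = proj₁ kills
      vanishes : Multiple 𝐅 P ℓ z × IsZero z → ∀ i → eval N X (mult ℓ i) ≈ₛ Q.0#
      vanishes (multiple , z≈0) i = Q.trans
        (eval-mult {x = X} {D} {N} X-nilpotent (ℕ.m≤m+n D q) (ℕ.≤-trans (ℕ.<⇒≤ 1<q) (ℕ.m≤n+m q D))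
          (proj₂ (multiple⇒iteratedSum 𝐅 X multiple)) i)
        (≈⇒≈ₛ (z≈0 i))

    slope-of : ∀ i → v (P i) ≡ [ μ ] → μ ≡ α ℓ 2<ℓ
    slope-of i vPi≡μ = ×ℚ≡1⇒≡1/ (q ℕ.∸ 1) (∙-cancelˡ μ ((q ℕ.∸ 1) ×ℚ μ) 1ℚ (begin
      suc (q ℕ.∸ 1) ×ℚ μ  ≡⟨ ≡.cong (_×ℚ μ) (ℕ.m+[n∸m]≡n (ℕ.<⇒≤ 1<q)) ⟩
      -- Level 1 of the determinant in ℤ_p is by definition the integer determinant of the reduced
      -- coefficients, so `nonsingular` applies directly. Cancelling μ from qμ = 1 + μ then leaves
      -- (q - 1) μ = 1.
      q ×ℚ μ              ≡⟨ slope (unit⇒coprime _ nonsingular) root i vPi≡μ ⟩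
      1ℚ ℚ.+ μ            ≡⟨ ℚ.+-comm 1ℚ μ ⟩
      μ ℚ.+ 1ℚ            ∎))
      where
      open ≡.≡-Reasoning
      open GroupProperties ℚ.+-0-group using (∙-cancelˡ)

  conclude : (∃ λ μ → 0ℚ ℚ.< μ × v (P 0F) ⊓⁺ v (P 1F) ≡ [ μ ] × [ μ ] ≤⁺ v (P 0F) × [ μ ] ≤⁺ v (P 1F) ×
               (v (P 0F) ≡ [ μ ] ⊎ v (P 1F) ≡ [ μ ])) →
             v (P 0F) ⊓⁺ v (P 1F) ≡ [ α ℓ 2<ℓ ]
  conclude (μ , 0<μ , min≡μ , μ≤P₀ , μ≤P₁ , attained) = ≡.trans min≡μ (≡.cong [_] (μ≡α attained))
    where
    μ≤P : ∀ i → [ μ ] ≤⁺ v (P i)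
    μ≤P 0F = μ≤P₀
    μ≤P 1F = μ≤P₁
    μ≡α : v (P 0F) ≡ [ μ ] ⊎ v (P 1F) ≡ [ μ ] → μ ≡ α ℓ 2<ℓ
    μ≡α (inj₁ vP₀≡μ) = slope-of 0<μ μ≤P 0F vP₀≡μ
    μ≡α (inj₂ vP₁≡μ) = slope-of 0<μ μ≤P 1F vP₁≡μ
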